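{- There exists an absolute constant $C>0$ such that for infinitely many positive integers $n$ there exists a set $W_n \subseteq \{1,\ldots,n\}$ of square-free integers with the following property: for every function $f: W_n \to \{ -1,+1\}$ there exists a positive integer $a$ such that $$\Bigl|\sum_{\substack{b \in W_n\\ a \mid b}} f(b)\Bigr| \;\geq\; n^{1/(C \log\log n)}.$$
   Context: Here $a \mid b$ means that $a$ divides $b$. An integer is square-free if it is not divisible by the square of any prime. The constant $C$ does not depend on $n$, $W_n$, $f$ or $a$. -}

module Defs where

open import Algebra.Definitions.RawSemiring using () renaming (_^_ to power)
open import Data.Fin using (Fin; toℕ)
open import Data.Fin.Subset using (Subset; _∈_)
open import Data.Fin.Subset.Properties using (_∈?_)
open import Data.Integer as ℤ using (ℤ; +_)
open import Data.Integer.Properties using () renaming (+-0-commutativeMonoid to ℤ-+)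
open import Data.Nat as ℕ using (ℕ; suc)
open import Data.Nat.Divisibility using (_∣_; _∣?_)
open import Data.Nat.Primality using (Prime)
open import Data.Product using (∃; _×_; _,_)
open import Data.Rational
open import Data.Sign using (Sign)
open import Data.Sum using (_⊎_)
open import Function using (_⇔_)
open import Relation.Nullary using (¬_; yes; no)

open import Algebra.Properties.CommutativeMonoid.Sum ℤ-+ using (sum)

------------------------------------------------------------------------
-- Real numbers as two-sided Dedekind cuts.
--
-- `lower x q` reads q < x and `upper x q` reads x < q.  The operations are
-- given on bare cuts; the cut axioms are collected in `IsReal`.

record Cut : Set₁ where
  constructor cut
  field
    lower : ℚ → Set
    upper : ℚ → Set

open Cut public

record IsReal (x : Cut) : Set where
  field
    lower-inhabited : ∃ (lower x)
    upper-inhabited : ∃ (upper x)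
    lower-rounded   : ∀ q → lower x q ⇔ (∃ λ r → q < r × lower x r)
    upper-rounded   : ∀ q → upper x q ⇔ (∃ λ r → r < q × upper x r)
    disjoint        : ∀ q → ¬ (lower x q × upper x q)
    located         : ∀ {q r} → q < r → lower x q ⊎ upper x r

infix  4 _<ℝ_ _≤ℝ_ _≥ℝ_
infixl 7 _*ℝ_
infixr 8 _^ℝ_
infix  9 _⁻¹

fromℚ : ℚ → Cut
fromℚ p = cut (_< p) (p <_)

fromℕ : ℕ → Cut
fromℕ n = fromℚ (+ n / 1)

_<ℝ_ : Cut → Cut → Set
x <ℝ y = ∃ λ q → upper x q × lower y q

_≤ℝ_ : Cut → Cut → Set
x ≤ℝ y = ∀ q → lower x q → lower y q

_≥ℝ_ : Cut → Cut → Set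
x ≥ℝ y = y ≤ℝ x

-- Interval multiplication: with a < x < b and c < y < d, the product x y lies
-- between the least and the greatest of a c, a d, b c, b d.
-- This is correct for reals of any sign.
_*ℝ_ : Cut → Cut → Cut
x *ℝ y = cut
  (λ q → Enclosed λ a b c d → q < a * c × q < a * d × q < b * c × q < b * d)
  (λ q → Enclosed λ a b c d → a * c < q × a * d < q × b * c < q × b * d < q)
  where
  Enclosed : (ℚ → ℚ → ℚ → ℚ → Set) → Set
  Enclosed P = ∃ λ a → ∃ λ b → ∃ λ c → ∃ λ d →
    (lower x a × upper x b × lower y c × upper y d) × P a b c d

-- The reciprocal of a positive real x: q < 1/x iff q u < 1 for some u > x, and
-- 1/x < q iff 1 < q u for some 0 < u < x.
_⁻¹ : Cut → Cut
x ⁻¹ = cut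
  (λ q → ∃ λ u → upper x u × q * u < 1ℚ)
  (λ q → ∃ λ u → 0ℚ < u × lower x u × 1ℚ < q * u)

_^ℚ_ : ℚ → ℕ → ℚ
_^ℚ_ = power +-*-rawSemiring

-- (1 + q / N) ^ N
compound : ℚ → (N : ℕ) → .{{ℕ.NonZero N}} → ℚ
compound q N = (1ℚ + q * (+ 1 / N)) ^ℚ N

-- e^q = lim (1 + q/N)^N.  For N > |q| the sequence (1 + q/N)^N is nondecreasing
-- and (1 - q/N)^(-N) is nonincreasing in N, both with limit e^q and equal to it
-- only when q = 0, so e^q is the supremum of the former and the infimum of the
-- latter.  The inequality (1 - q/N)^(-N) < r is written without division.
expℚ : ℚ → Cut
expℚ q = cut
  (λ r → ∃ λ k → ∣ q ∣ < + suc k / 1 × r < compound q (suc k))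
  (λ r → ∃ λ k → ∣ q ∣ < + suc k / 1 × 1ℚ < r * compound (- q) (suc k))

-- exp is the increasing extension of expℚ to the reals.
exp : Cut → Cut
exp x = cut
  (λ r → ∃ λ q → lower x q × lower (expℚ q) r)
  (λ r → ∃ λ q → upper x q × upper (expℚ q) r)

-- The natural logarithm of a positive real: q < log x iff e^q < x.
log : Cut → Cut
log x = cut (λ q → expℚ q <ℝ x) (λ q → x <ℝ expℚ q)

-- Real powers of a positive base.
_^ℝ_ : Cut → Cut → Cut
x ^ℝ y = exp (y *ℝ log x)

------------------------------------------------------------------------

SquareFree : ℕ → Set
SquareFree b = ∀ p → Prime p → ¬ (p ℕ.^ 2 ∣ b)

-- A subset of {1,…,n} is a `Subset n` in which i : Fin n stands for the
-- integer 1 + toℕ i.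
value : ∀ {n} → Fin n → ℕ
value i = suc (toℕ i)

Colouring : ∀ {n} → Subset n → Set
Colouring W = ∃ (_∈ W) → Sign

sign : Sign → ℤ
sign s = s ℤ.◃ 1

-- The sum of f(b) over b ∈ W with a ∣ b.
multipleSum : ∀ {n} (W : Subset n) → Colouring W → ℕ → ℤ
multipleSum {n} W f a = sum term
  where
  term : Fin n → ℤ
  term i with i ∈? W | a ∣? value i
  ... | yes i∈W | yes _ = sign (f (i , i∈W))
  ... | yes _   | no _  = ℤ.0ℤ
  ... | no _    | _     = ℤ.0ℤ

{-# OPTIONS --safe #-}

-- On the four-point set consider its six pairs.  For h : {0,1,2,3} → ℤ,
--   ∑_{pairs {i,j}} (h i + h j)² = 2 ∑ (h i)² + (∑ h i)² ≥ 2 ∑ (h i)²,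
-- and this inequality tensorises: for G = ±1 on {0,1,2,3}ᵗ the squares of the
-- sums of G over the 6ᵗ boxes (products of pairs) add up to at least 2ᵗ 4ᵗ, so
-- some box has |sum| ≥ (8/6)^(t/2).  Attach distinct primes to the 6t pairs in t
-- copies of the four-point set, and send a point x to the product b_x of the
-- primes of the pairs through its coordinates.  Each b_x is square-free with 3t
-- prime factors, and a box is the set of x for which b_x is a multiple of the
-- product of its primes.
--
-- With t = 2ˢ Chebyshev's bound (every common multiple of 1,…,N is at least
-- 2^(N-2), whereas one of them is at most N^π(N)) supplies 6t primes below 2^(8s).
-- Hence n = 2^(24 s t) works: log n ≤ 24 s t and log log n ≥ s/2, so
-- log n / (384 log log n) ≤ t/8, and e^(t/8) ≤ (8/7)ᵗ ≤ (8/6)^(t/2).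

module Submission where

open import Defs

module Powers where

  open import Data.Nat
  open import Data.Nat.Properties
  open import Relation.Binary.PropositionalEquality using (_≡_; refl; trans; cong)

  ^-distribʳ-* : ∀ m n o → (m * n) ^ o ≡ m ^ o * n ^ o
  ^-distribʳ-* m n zero    = refl
  ^-distribʳ-* m n (suc o) = trans (cong (m * n *_) (^-distribʳ-* m n o))
                                   ([m*n]*[o*p]≡[m*o]*[n*p] m n (m ^ o) (n ^ o))

-- Rational bounds for exp and log, and the real power in the conclusion.

module RealPowers where

  open Powers
  open import Algebra.Bundles using (CommutativeRing)
  open import Data.Integer as ℤ using (+_)
  import Data.Integer.Properties as ℤ
  open import Data.Nat as ℕ using (ℕ; zero; suc)
  import Data.Nat.Properties as ℕ
  open import Data.Nat.Tactic.RingSolver using (solve-∀)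
  open import Data.Product using (_,_)
  open import Data.Rational
  open import Data.Rational.Properties
  open import Data.Rational.Solver using (module +-*-Solver)
  import Data.Rational.Unnormalised as ℚᵘ
  import Data.Rational.Unnormalised.Properties as ℚᵘ
  open import Data.Sum using (_⊎_; inj₁; inj₂) renaming ([_,_]′ to either)
  open import Function using (mk⇔)
  open import Relation.Binary.PropositionalEquality
    using (_≡_; refl; sym; trans; cong; cong₂; subst; subst₂; module ≡-Reasoning)
  open import Relation.Nullary using (¬_; yes; no; contradiction)

  open import Algebra.Properties.CommutativeSemiring.Exp
    (CommutativeRing.commutativeSemiring +-*-commutativeRing)
    using (^-assocʳ; ^-distrib-*)

  open +-*-Solver using (solve; _:=_; _:+_; _:*_; :-_; con)

  -- This is definitionally the rational inside `fromℕ n`, so bounds on `ι` apply to that cut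
  -- directly.
  ι : ℕ → ℚ
  ι n = + n / 1

  -- Normalisation in `_/_` blocks computation on a variable `n`; the unnormalised fraction n/1
  -- turns identities about `ι` into identities of integers.
  ιᵘ : ℕ → ℚᵘ.ℚᵘ
  ιᵘ n = ℚᵘ.mkℚᵘ (+ n) 0

  ι-hom-+ : ∀ m n → ι (m ℕ.+ n) ≡ ι m + ι n
  ι-hom-+ m n = toℚᵘ-injective (begin
    toℚᵘ (ι (m ℕ.+ n))          ≈⟨ toℚᵘ-fromℚᵘ (ιᵘ (m ℕ.+ n)) ⟩
    ιᵘ (m ℕ.+ n)                ≈⟨ ℚᵘ.*≡* (cong (ℤ._* + 1) (cong₂ ℤ._+_ (sym (ℤ.*-identityʳ (+ m))) (sym (ℤ.*-identityʳ (+ n))))) ⟩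
    ιᵘ m ℚᵘ.+ ιᵘ n              ≈⟨ ℚᵘ.+-cong (toℚᵘ-fromℚᵘ (ιᵘ m)) (toℚᵘ-fromℚᵘ (ιᵘ n)) ⟨
    toℚᵘ (ι m) ℚᵘ.+ toℚᵘ (ι n)  ≈⟨ toℚᵘ-homo-+ (ι m) (ι n) ⟨
    toℚᵘ (ι m + ι n)            ∎)
    where open ℚᵘ.≃-Reasoning

  ι-hom-* : ∀ m n → ι (m ℕ.* n) ≡ ι m * ι n
  ι-hom-* m n = toℚᵘ-injective (begin
    toℚᵘ (ι (m ℕ.* n))          ≈⟨ toℚᵘ-fromℚᵘ (ιᵘ (m ℕ.* n)) ⟩
    ιᵘ (m ℕ.* n)                ≈⟨ ℚᵘ.*≡* (cong (ℤ._* + 1) (ℤ.pos-* m n)) ⟩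
    ιᵘ m ℚᵘ.* ιᵘ n              ≈⟨ ℚᵘ.*-cong (toℚᵘ-fromℚᵘ (ιᵘ m)) (toℚᵘ-fromℚᵘ (ιᵘ n)) ⟨
    toℚᵘ (ι m) ℚᵘ.* toℚᵘ (ι n)  ≈⟨ toℚᵘ-homo-* (ι m) (ι n) ⟨
    toℚᵘ (ι m * ι n)            ∎)
    where open ℚᵘ.≃-Reasoning

  ι-hom-^ : ∀ m n → ι (m ℕ.^ n) ≡ ι m ^ℚ n
  ι-hom-^ m zero    = refl
  ι-hom-^ m (suc n) = trans (ι-hom-* m (m ℕ.^ n)) (cong (ι m *_) (ι-hom-^ m n))

  ι-mono-≤ : ∀ {m n} → m ℕ.≤ n → ι m ≤ ι n
  ι-mono-≤ {m} {n} m≤n = toℚᵘ-cancel-≤ (ℚᵘ.≤-respˡ-≃ (ℚᵘ.≃-sym (toℚᵘ-fromℚᵘ (ιᵘ m)))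
    (ℚᵘ.≤-respʳ-≃ (ℚᵘ.≃-sym (toℚᵘ-fromℚᵘ (ιᵘ n)))
      (ℚᵘ.*≤* (ℤ.*-monoʳ-≤-nonNeg (+ 1) (ℤ.+≤+ m≤n)))))

  0≤ι : ∀ n → 0ℚ ≤ ι n
  0≤ι n = ι-mono-≤ {0} {n} ℕ.z≤n

  ι*1/ : ∀ k → ι (suc k) * (+ 1 / suc k) ≡ 1ℚ
  ι*1/ k = toℚᵘ-injective (begin
    toℚᵘ (ι (suc k) * (+ 1 / suc k))          ≈⟨ toℚᵘ-homo-* (ι (suc k)) (+ 1 / suc k) ⟩
    toℚᵘ (ι (suc k)) ℚᵘ.* toℚᵘ (+ 1 / suc k)  ≈⟨ ℚᵘ.*-cong (toℚᵘ-fromℚᵘ (ιᵘ (suc k))) (toℚᵘ-fromℚᵘ (ℚᵘ.mkℚᵘ (+ 1) k)) ⟩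
    ιᵘ (suc k) ℚᵘ.* ℚᵘ.mkℚᵘ (+ 1) k           ≈⟨ ℚᵘ.*-inverseʳ (ιᵘ (suc k)) ⟩
    toℚᵘ 1ℚ                                   ∎)
    where open ℚᵘ.≃-Reasoning

  *-monoˡ : ∀ {p q r} → 0ℚ ≤ r → p ≤ q → p * r ≤ q * r
  *-monoˡ {r = r} 0≤r = *-monoʳ-≤-nonNeg r {{nonNegative 0≤r}}

  *-mono : ∀ {p q r s} → 0ℚ ≤ p → p ≤ q → 0ℚ ≤ r → r ≤ s → p * r ≤ q * s
  *-mono {p} {q} {r} {s} 0≤p p≤q 0≤r r≤s =
    ≤-trans (*-monoˡ 0≤r p≤q) (*-monoˡ-≤-nonNeg q {{nonNegative (≤-trans 0≤p p≤q)}} r≤s)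

  *-nonNeg : ∀ {p q} → 0ℚ ≤ p → 0ℚ ≤ q → 0ℚ ≤ p * q
  *-nonNeg {p} {q} 0≤p 0≤q = subst (_≤ p * q) (*-zeroˡ q) (*-monoˡ 0≤q 0≤p)

  ^-nonNeg : ∀ {p} → 0ℚ ≤ p → ∀ n → 0ℚ ≤ p ^ℚ n
  ^-nonNeg 0≤p zero    = nonNegative⁻¹ 1ℚ
  ^-nonNeg 0≤p (suc n) = *-nonNeg 0≤p (^-nonNeg 0≤p n)

  ^-mono : ∀ {p q} → 0ℚ ≤ p → p ≤ q → ∀ n → p ^ℚ n ≤ q ^ℚ n
  ^-mono 0≤p p≤q zero    = ≤-refl
  ^-mono 0≤p p≤q (suc n) = *-mono 0≤p p≤q (^-nonNeg 0≤p n) (^-mono 0≤p p≤q n)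

  1^n≡1 : ∀ n → 1ℚ ^ℚ n ≡ 1ℚ
  1^n≡1 zero    = refl
  1^n≡1 (suc n) = trans (*-identityˡ _) (1^n≡1 n)

  ^-≤1 : ∀ {p} → 0ℚ ≤ p → p ≤ 1ℚ → ∀ n → p ^ℚ n ≤ 1ℚ
  ^-≤1 {p} 0≤p p≤1 n = subst (p ^ℚ n ≤_) (1^n≡1 n) (^-mono 0≤p p≤1 n)

  ^-comm : ∀ p m n → (p ^ℚ m) ^ℚ n ≡ (p ^ℚ n) ^ℚ m
  ^-comm p m n = begin
    (p ^ℚ m) ^ℚ n   ≡⟨ ^-assocʳ p m n ⟩
    p ^ℚ (m ℕ.* n)  ≡⟨ cong (p ^ℚ_) (ℕ.*-comm m n) ⟩
    p ^ℚ (n ℕ.* m)  ≡⟨ ^-assocʳ p n m ⟨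
    (p ^ℚ n) ^ℚ m   ∎
    where open ≡-Reasoning

  p≤q⇒0≤q-p : ∀ {p q} → p ≤ q → 0ℚ ≤ q + - p
  p≤q⇒0≤q-p {p} {q} p≤q = subst (_≤ q + - p) (+-inverseʳ p) (+-monoˡ-≤ (- p) p≤q)

  0≤q-p⇒p≤q : ∀ {p q} → 0ℚ ≤ q + - p → p ≤ q
  0≤q-p⇒p≤q {p} {q} h = subst₂ _≤_ (+-identityˡ p)
    (solve 2 (λ p q → (q :+ :- p) :+ p := q) refl p q) (+-monoˡ-≤ p h)

  0≤p² : ∀ p → 0ℚ ≤ p * p
  0≤p² p with ≤-total 0ℚ p
  ... | inj₁ 0≤p = *-nonNeg 0≤p 0≤p
  ... | inj₂ p≤0 = subst (0ℚ ≤_) (solve 1 (λ p → (:- p) :* (:- p) := p :* p) refl p)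
                     (*-nonNeg (neg-antimono-≤ p≤0) (neg-antimono-≤ p≤0))

  bernoulli : ∀ {x} → 0ℚ ≤ 1ℚ + x → ∀ n → 1ℚ + ι n * x ≤ (1ℚ + x) ^ℚ n
  bernoulli {x} 0≤1+x zero    = ≤-reflexive (trans (cong (λ z → 1ℚ + z) (*-zeroˡ x)) (+-identityʳ 1ℚ))
  bernoulli {x} 0≤1+x (suc n) = begin
    1ℚ + ι (suc n) * x                 ≡⟨ cong (λ z → 1ℚ + z * x) (ι-hom-+ 1 n) ⟩
    1ℚ + (1ℚ + ι n) * x                ≡⟨ +-identityʳ _ ⟨
    -- Adding n x² completes the product (1 + n x)(1 + x).
    1ℚ + (1ℚ + ι n) * x + 0ℚ           ≤⟨ +-monoʳ-≤ (1ℚ + (1ℚ + ι n) * x) (*-nonNeg (0≤ι n) (0≤p² x)) ⟩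
    1ℚ + (1ℚ + ι n) * x + ι n * (x * x)
      ≡⟨ solve 2 (λ m x → con 1ℚ :+ (con 1ℚ :+ m) :* x :+ m :* (x :* x)
                       := (con 1ℚ :+ m :* x) :* (con 1ℚ :+ x)) refl (ι n) x ⟩
    (1ℚ + ι n * x) * (1ℚ + x)          ≤⟨ *-monoˡ 0≤1+x (bernoulli 0≤1+x n) ⟩
    (1ℚ + x) ^ℚ n * (1ℚ + x)           ≡⟨ *-comm ((1ℚ + x) ^ℚ n) (1ℚ + x) ⟩
    (1ℚ + x) * (1ℚ + x) ^ℚ n           ∎
    where open ≤-Reasoning

  -- The product of the bases is 1 - x², which lies in [0, 1].
  conjugate-powers≤1 : ∀ {x} → 0ℚ ≤ x → x ≤ 1ℚ → ∀ n → (1ℚ + x) ^ℚ n * (1ℚ + - x) ^ℚ n ≤ 1ℚ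
  conjugate-powers≤1 {x} 0≤x x≤1 n =
    subst (_≤ 1ℚ) (^-distrib-* (1ℚ + x) (1ℚ + - x) n)
      (^-≤1 (*-nonNeg (≤-trans 0≤x (subst (_≤ 1ℚ + x) (+-identityˡ x) (+-monoˡ-≤ x (nonNegative⁻¹ 1ℚ))))
                      (p≤q⇒0≤q-p x≤1))
            (0≤q-p⇒p≤q (subst (0ℚ ≤_)
               (solve 1 (λ x → x :* x := con 1ℚ :+ :- ((con 1ℚ :+ x) :* (con 1ℚ :+ :- x))) refl x)
               (0≤p² x)))
            n)

  1/-nonNeg : ∀ k → 0ℚ ≤ + 1 / suc k
  1/-nonNeg k = nonNegative⁻¹ (+ 1 / suc k) {{normalize-nonNeg 1 (suc k)}}

  1/-≤1 : ∀ k → + 1 / suc k ≤ 1ℚ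
  1/-≤1 k = subst₂ _≤_ (*-identityˡ _) (ι*1/ k) (*-monoˡ (1/-nonNeg k) (ι-mono-≤ {1} {suc k} (ℕ.s≤s ℕ.z≤n)))

  p≤∣p∣ : ∀ p → p ≤ ∣ p ∣
  p≤∣p∣ p with ∣p∣≡p∨∣p∣≡-p p | ≤-total 0ℚ p
  ... | inj₁ eq | _        = ≤-reflexive (sym eq)
  ... | inj₂ eq | inj₁ 0≤p = ≤-reflexive (sym (0≤p⇒∣p∣≡p 0≤p))
  ... | inj₂ eq | inj₂ p≤0 = ≤-trans p≤0 (0≤∣p∣ p)

  -- 1 + q/N = (N + q)/N, and -q ≤ |q| < N.
  0≤1+q/N : ∀ {q} k → ∣ q ∣ < ι (suc k) → 0ℚ ≤ 1ℚ + q * (+ 1 / suc k)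
  0≤1+q/N {q} k ∣q∣<N = subst (0ℚ ≤_)
    (trans (cong₂ _+_ (ι*1/ k) (sym (neg-distribˡ-* (- q) h))) (cong (λ z → 1ℚ + z) (solve 2 (λ q h → :- ((:- q) :* h) := q :* h) refl q h)))
    (subst (0ℚ ≤_) (*-distribʳ-+ h (ι (suc k)) (- (- q)))
      (*-nonNeg (p≤q⇒0≤q-p (≤-trans (subst (- q ≤_) (∣-p∣≡∣p∣ q) (p≤∣p∣ (- q))) (<⇒≤ ∣q∣<N)))
                (1/-nonNeg k)))
    where h = + 1 / suc k

  compound-nonNeg : ∀ {q} k → ∣ q ∣ < ι (suc k) → 0ℚ ≤ compound q (suc k)
  compound-nonNeg k ∣q∣<N = ^-nonNeg (0≤1+q/N k ∣q∣<N) (suc k)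

  -- e^(tδ) ≤ (1 - δ)^(-t).
  compound-upper : ∀ {q δ} t k → ∣ q ∣ < ι (suc k) → 0ℚ ≤ δ → δ ≤ 1ℚ → q ≤ ι t * δ →
                   compound q (suc k) * (1ℚ + - δ) ^ℚ t ≤ 1ℚ
  compound-upper {q} {δ} t k ∣q∣<N 0≤δ δ≤1 q≤tδ = begin
    (1ℚ + q * h) ^ℚ K * (1ℚ + - δ) ^ℚ t
      ≤⟨ *-monoˡ (^-nonNeg 0≤1-δ t) (^-mono (0≤1+q/N k ∣q∣<N) 1+qh≤ K) ⟩
    ((1ℚ + δh) ^ℚ t) ^ℚ K * (1ℚ + - δ) ^ℚ t
      ≡⟨ cong (_* (1ℚ + - δ) ^ℚ t) (^-comm (1ℚ + δh) t K) ⟩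
    ((1ℚ + δh) ^ℚ K) ^ℚ t * (1ℚ + - δ) ^ℚ t
      ≡⟨ ^-distrib-* ((1ℚ + δh) ^ℚ K) (1ℚ + - δ) t ⟨
    ((1ℚ + δh) ^ℚ K * (1ℚ + - δ)) ^ℚ t
      ≤⟨ ^-≤1 (*-nonNeg 0≤A 0≤1-δ) step t ⟩
    1ℚ ∎
    where
    open ≤-Reasoning
    K = suc k
    h = + 1 / suc k
    δh = δ * h
    0≤δh : 0ℚ ≤ δh
    0≤δh = *-nonNeg 0≤δ (1/-nonNeg k)
    δh≤1 : δh ≤ 1ℚ
    δh≤1 = *-mono 0≤δ δ≤1 (1/-nonNeg k) (1/-≤1 k)
    0≤1-δ : 0ℚ ≤ 1ℚ + - δ
    0≤1-δ = p≤q⇒0≤q-p δ≤1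
    0≤1+δh : 0ℚ ≤ 1ℚ + δh
    0≤1+δh = ≤-trans 0≤δh (subst (_≤ 1ℚ + δh) (+-identityˡ δh) (+-monoˡ-≤ δh (nonNegative⁻¹ 1ℚ)))
    0≤A : 0ℚ ≤ (1ℚ + δh) ^ℚ K
    0≤A = ^-nonNeg 0≤1+δh K
    -- Bernoulli gives 1 + qh ≤ 1 + tδh ≤ (1 + δh)^t. Everything is then a t-th power, and (1 +
    -- δh)^K (1 - δ) ≤ 1 suffices.
    1+qh≤ : 1ℚ + q * h ≤ (1ℚ + δh) ^ℚ t
    1+qh≤ = ≤-trans (+-monoʳ-≤ 1ℚ (subst (q * h ≤_) (*-assoc (ι t) δ h) (*-monoˡ (1/-nonNeg k) q≤tδ)))
                    (bernoulli 0≤1+δh t)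
    -- As Kh = 1, Bernoulli for -δh produces the conjugate of (1 + δh)^K.
    1-δ≤ : 1ℚ + - δ ≤ (1ℚ + - δh) ^ℚ K
    1-δ≤ = subst (_≤ (1ℚ + - δh) ^ℚ K) (cong (λ z → 1ℚ + z) eq) (bernoulli (p≤q⇒0≤q-p δh≤1) K)
      where
      eq : ι K * - δh ≡ - δ
      eq = trans (solve 3 (λ K δ h → K :* (:- (δ :* h)) := :- ((K :* h) :* δ)) refl (ι K) δ h)
                 (cong -_ (trans (cong (_* δ) (ι*1/ k)) (*-identityˡ δ)))
    step : (1ℚ + δh) ^ℚ K * (1ℚ + - δ) ≤ 1ℚ
    step = ≤-trans (*-monoˡ-≤-nonNeg ((1ℚ + δh) ^ℚ K) {{nonNegative 0≤A}} 1-δ≤) (conjugate-powers≤1 0≤δh δh≤1 K)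

  -- From (1 + 1/N)^N ≥ 2, applied to (1 - 1/N)^N (1 + 1/N)^N ≤ 1.
  compound-lower : ∀ {c} T k → ∣ c ∣ < ι (suc k) → ι T ≤ c → compound (- c) (suc k) * ι 2 ^ℚ T ≤ 1ℚ
  compound-lower {c} T k ∣c∣<N T≤c = begin
    (1ℚ + - c * h) ^ℚ K * ι 2 ^ℚ T
      ≤⟨ *-mono (^-nonNeg 0≤ K) (^-mono 0≤ ≤A K) (^-nonNeg (0≤ι 2) T) (^-mono (0≤ι 2) 2≤ T) ⟩
    ((1ℚ + - h) ^ℚ T) ^ℚ K * ((1ℚ + h) ^ℚ K) ^ℚ T
      ≡⟨ cong (((1ℚ + - h) ^ℚ T) ^ℚ K *_) (^-comm (1ℚ + h) K T) ⟩
    ((1ℚ + - h) ^ℚ T) ^ℚ K * ((1ℚ + h) ^ℚ T) ^ℚ K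
      ≡⟨ *-comm _ (((1ℚ + h) ^ℚ T) ^ℚ K) ⟩
    ((1ℚ + h) ^ℚ T) ^ℚ K * ((1ℚ + - h) ^ℚ T) ^ℚ K
      ≡⟨ ^-distrib-* ((1ℚ + h) ^ℚ T) ((1ℚ + - h) ^ℚ T) K ⟨
    ((1ℚ + h) ^ℚ T * (1ℚ + - h) ^ℚ T) ^ℚ K
      ≤⟨ ^-≤1 (*-nonNeg (^-nonNeg 0≤1+h T) (^-nonNeg 0≤1-h T)) (conjugate-powers≤1 0≤h (1/-≤1 k) T) K ⟩
    1ℚ ∎
    where
    open ≤-Reasoning
    K = suc k
    h = + 1 / suc k
    0≤h : 0ℚ ≤ h
    0≤h = 1/-nonNeg k
    0≤1-h : 0ℚ ≤ 1ℚ + - h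
    0≤1-h = p≤q⇒0≤q-p (1/-≤1 k)
    0≤1+h : 0ℚ ≤ 1ℚ + h
    0≤1+h = ≤-trans 0≤h (subst (_≤ 1ℚ + h) (+-identityˡ h) (+-monoˡ-≤ h (nonNegative⁻¹ 1ℚ)))
    0≤ : 0ℚ ≤ 1ℚ + - c * h
    0≤ = 0≤1+q/N k (subst (_< ι K) (sym (∣-p∣≡∣p∣ c)) ∣c∣<N)
    ≤A : 1ℚ + - c * h ≤ (1ℚ + - h) ^ℚ T
    ≤A = ≤-trans (+-monoʳ-≤ 1ℚ (subst (- c * h ≤_)
                    (solve 2 (λ T h → (:- T) :* h := T :* (:- h)) refl (ι T) h)
                    (*-monoˡ 0≤h (neg-antimono-≤ T≤c))))
                 (bernoulli 0≤1-h T)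
    2≤ : ι 2 ≤ (1ℚ + h) ^ℚ K
    2≤ = subst (_≤ (1ℚ + h) ^ℚ K) (cong (λ z → 1ℚ + z) (ι*1/ k)) (bernoulli 0≤1+h K)

  fromℚ-isReal : ∀ p → IsReal (fromℚ p)
  fromℚ-isReal p = record
    { lower-inhabited = p - 1ℚ , subst (p - 1ℚ <_) (+-identityʳ p) (+-monoʳ-< p (negative⁻¹ (- 1ℚ)))
    ; upper-inhabited = p + 1ℚ , subst (_< p + 1ℚ) (+-identityʳ p) (+-monoʳ-< p (positive⁻¹ 1ℚ))
    ; lower-rounded   = λ q → mk⇔ (λ q<p → let r , q<r , r<p = <-dense q<p in r , q<r , r<p)
                                   (λ (r , q<r , r<p) → <-trans q<r r<p)
    ; upper-rounded   = λ q → mk⇔ (λ p<q → let r , p<r , r<q = <-dense p<q in r , r<q , p<r)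
                                   (λ (r , r<q , p<r) → <-trans p<r r<q)
    ; disjoint        = λ q (q<p , p<q) → <-asym q<p p<q
    ; located         = located
    }
    where
    located : ∀ {q r} → q < r → q < p ⊎ p < r
    located {q} q<r with q <? p
    ... | yes q<p = inj₁ q<p
    ... | no  q≮p = inj₂ (≤-<-trans (≮⇒≥ q≮p) q<r)

  <⇒≱ : ∀ {p q} → p < q → ¬ (q ≤ p)
  <⇒≱ p<q q≤p = <-irrefl refl (<-≤-trans p<q q≤p)

  -- The case δ = 1/2 of `compound-upper`: e^(t/2) ≤ (1 - 1/2)^(-t) = 2^t.
  compound≤2^ : ∀ {q} t k → ∣ q ∣ < ι (suc k) → q ≤ ι t * ½ → compound q (suc k) ≤ ι (2 ℕ.^ t)
  compound≤2^ {q} t k ∣q∣<N q≤t/2 = begin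
    e                            ≡⟨ *-identityʳ e ⟨
    e * 1ℚ                       ≡⟨ cong (e *_) (1^n≡1 t) ⟨
    e * (½ * ι 2) ^ℚ t           ≡⟨ cong (e *_) (^-distrib-* ½ (ι 2) t) ⟩
    e * (½ ^ℚ t * ι 2 ^ℚ t)      ≡⟨ *-assoc e (½ ^ℚ t) (ι 2 ^ℚ t) ⟨
    e * ½ ^ℚ t * ι 2 ^ℚ t        ≤⟨ *-monoˡ (^-nonNeg (0≤ι 2) t)
                                      (compound-upper t k ∣q∣<N (nonNegative⁻¹ ½) (≤ᵇ⇒≤ _) q≤t/2) ⟩
    1ℚ * ι 2 ^ℚ t                ≡⟨ *-identityˡ _ ⟩
    ι 2 ^ℚ t                     ≡⟨ ι-hom-^ 2 t ⟨
    ι (2 ℕ.^ t)                  ∎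
    where
    open ≤-Reasoning
    e = compound q (suc k)

  2^<compound⇒ : ∀ {q} t k → ∣ q ∣ < ι (suc k) → ι (2 ℕ.^ t) < compound q (suc k) → ι t * ½ < q
  2^<compound⇒ {q} t k ∣q∣<N 2^t<e = ≰⇒> λ q≤t/2 → <⇒≱ 2^t<e (compound≤2^ t k ∣q∣<N q≤t/2)

  -- This is log 2^t ≥ t/2: the cut supplies a rational between 2^t and e^d, and e^d > 2^t forces d
  -- > t/2.
  upper-log-2^ : ∀ {d} t → upper (log (fromℕ (2 ℕ.^ t))) d → ι t * ½ < d
  upper-log-2^ t (p , n<p , k , ∣d∣<N , p<e) = 2^<compound⇒ t k ∣d∣<N (<-trans n<p p<e)

  -- This is log 2^T ≤ T. A witness `p` < 2^T with 1 < p (1 - c/N)^N contradicts `compound-lower` as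
  -- soon as c > T.
  lower-log-2^ : ∀ {c} T → lower (log (fromℕ (2 ℕ.^ T))) c → c ≤ ι T
  lower-log-2^ {c} T (p , (k , ∣c∣<N , 1<pe) , p<n) = ≮⇒≥ λ T<c → <⇒≱ 1<pe (begin
      p * e             ≤⟨ *-monoˡ (compound-nonNeg k (subst (_< ι (suc k)) (sym (∣-p∣≡∣p∣ c)) ∣c∣<N)) (<⇒≤ p<n) ⟩
      ι (2 ℕ.^ T) * e   ≡⟨ cong (_* e) (ι-hom-^ 2 T) ⟩
      ι 2 ^ℚ T * e      ≡⟨ *-comm (ι 2 ^ℚ T) e ⟩
      e * ι 2 ^ℚ T      ≤⟨ compound-lower T k ∣c∣<N (<⇒≤ T<c) ⟩
      1ℚ                ∎)
    where
    open ≤-Reasoning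
    e = compound (- c) (suc k)

  ⅛ : ℚ
  ⅛ = + 1 / 8

  -- The case δ = 1/8 of `compound-upper`, e^(t/8) ≤ (8/7)^t, with the denominator cleared so that
  -- it meets an inequality of naturals.
  compound≤8/7^ : ∀ {q} t k → ∣ q ∣ < ι (suc k) → q ≤ ι t * ⅛ →
                  compound q (suc k) * ι (7 ℕ.^ t) ≤ ι (8 ℕ.^ t)
  compound≤8/7^ {q} t k ∣q∣<N q≤t/8 = begin
    e * ι (7 ℕ.^ t)                  ≡⟨ cong (e *_) (ι-hom-^ 7 t) ⟩
    -- 7 = (1 - 1/8) · 8 by computation.
    e * ((1ℚ + - ⅛) * ι 8) ^ℚ t      ≡⟨ cong (e *_) (^-distrib-* (1ℚ + - ⅛) (ι 8) t) ⟩
    e * ((1ℚ + - ⅛) ^ℚ t * ι 8 ^ℚ t) ≡⟨ *-assoc e _ (ι 8 ^ℚ t) ⟨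
    e * (1ℚ + - ⅛) ^ℚ t * ι 8 ^ℚ t   ≤⟨ *-monoˡ (^-nonNeg (0≤ι 8) t)
                                          (compound-upper t k ∣q∣<N (nonNegative⁻¹ ⅛) (≤ᵇ⇒≤ _) q≤t/8) ⟩
    1ℚ * ι 8 ^ℚ t                    ≡⟨ *-identityˡ _ ⟩
    ι 8 ^ℚ t                         ≡⟨ ι-hom-^ 8 t ⟨
    ι (8 ℕ.^ t)                      ∎
    where
    open ≤-Reasoning
    e = compound q (suc k)

  -- (8/7)² ≤ 8/6.
  8^t≤D*7^t : ∀ t D → 8 ℕ.^ t ℕ.≤ 6 ℕ.^ t ℕ.* (D ℕ.* D) → 8 ℕ.^ t ℕ.≤ D ℕ.* 7 ℕ.^ t
  8^t≤D*7^t t D h with 8 ℕ.^ t ℕ.≤? D ℕ.* 7 ℕ.^ t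
  ... | yes le = le
  ... | no nle = contradiction (ℕ.*-mono-< (ℕ.≰⇒> nle) (ℕ.≰⇒> nle)) (ℕ.≤⇒≯ (begin
      8 ℕ.^ t ℕ.* 8 ℕ.^ t                      ≤⟨ ℕ.*-monoʳ-≤ (8 ℕ.^ t) h ⟩
      8 ℕ.^ t ℕ.* (6 ℕ.^ t ℕ.* (D ℕ.* D))      ≡⟨ ℕ.*-assoc (8 ℕ.^ t) (6 ℕ.^ t) (D ℕ.* D) ⟨
      8 ℕ.^ t ℕ.* 6 ℕ.^ t ℕ.* (D ℕ.* D)        ≡⟨ cong (ℕ._* (D ℕ.* D)) (^-distribʳ-* 8 6 t) ⟨
      48 ℕ.^ t ℕ.* (D ℕ.* D)                   ≤⟨ ℕ.*-monoˡ-≤ (D ℕ.* D) (ℕ.^-monoˡ-≤ t (ℕ.n≤1+n 48)) ⟩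
      49 ℕ.^ t ℕ.* (D ℕ.* D)                   ≡⟨ cong (ℕ._* (D ℕ.* D)) (^-distribʳ-* 7 7 t) ⟩
      7 ℕ.^ t ℕ.* 7 ℕ.^ t ℕ.* (D ℕ.* D)        ≡⟨ lemma (7 ℕ.^ t) D ⟩
      D ℕ.* 7 ℕ.^ t ℕ.* (D ℕ.* 7 ℕ.^ t)        ∎))
    where
    open ℕ.≤-Reasoning
    lemma : ∀ a b → a ℕ.* a ℕ.* (b ℕ.* b) ≡ b ℕ.* a ℕ.* (b ℕ.* a)
    lemma = solve-∀

  -- The proof opens the cuts. A rational `r` below the power comes with `q` below the exponent and
  -- `r` < e^`q`. Here `q` is below `a * c` and `a * d`, where `c` < log n < `d` and `a * u` < 1 for
  -- some `u` above `C⁺ * ℓ⁺`, with `C⁺` above 384 and `ℓ⁺` above log log n. It then suffices that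
  -- `q` ≤ t/8.
  real-power-bound : ∀ s D → 1 ℕ.≤ s → let t = 2 ℕ.^ s; n = 2 ℕ.^ (24 ℕ.* (s ℕ.* t)) in
    8 ℕ.^ t ℕ.≤ 6 ℕ.^ t ℕ.* (D ℕ.* D) →
    fromℕ D ≥ℝ fromℕ n ^ℝ ((fromℕ 384 *ℝ log (log (fromℕ n))) ⁻¹)
  real-power-bound s D 1≤s 8^t≤6^tD² r
    ( q
    , ( a , _ , c , d
      , ((u , (_ , C⁺ , _ , ℓ⁺ , (_ , C<C⁺ , _ , (p , logn<p , k₁ , ∣ℓ⁺∣<N , p<e)) , _ , _ , _ , C⁺ℓ⁺<u) , au<1)
        , _ , c<logn , logn<d)
      , q<ac , q<ad , _ , _)
    , k , ∣q∣<N , r<e)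
    = <-≤-trans r<e (*-cancelʳ-≤-pos (ι (7 ℕ.^ t)) {{normalize-pos (7 ℕ.^ t) 1 {{_}} {{ℕ.m^n≢0 7 t}}}} (begin
        compound q (suc k) * ι (7 ℕ.^ t)  ≤⟨ compound≤8/7^ t k ∣q∣<N q≤t/8 ⟩
        ι (8 ℕ.^ t)                       ≤⟨ ι-mono-≤ (8^t≤D*7^t t D 8^t≤6^tD²) ⟩
        ι (D ℕ.* 7 ℕ.^ t)                 ≡⟨ ι-hom-* D (7 ℕ.^ t) ⟩
        ι D * ι (7 ℕ.^ t)                 ∎))
    where
    open ≤-Reasoning
    t = 2 ℕ.^ s
    T = 24 ℕ.* (s ℕ.* t)

    -- As s ≥ 1, T ≥ 2t and log n ≥ T/2 ≥ t. Since t = 2^s, the same kind of bound then applies to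
    -- the second logarithm.
    t<upper-log : ∀ {x} → upper (log (fromℕ (2 ℕ.^ T))) x → ι t < x
    t<upper-log {x} logn<x = ≤-<-trans (begin
        ι t                  ≡⟨ *-identityʳ (ι t) ⟨
        ι t * (ι 2 * ½)      ≡⟨ *-assoc (ι t) (ι 2) ½ ⟨
        ι t * ι 2 * ½        ≡⟨ cong (_* ½) (ι-hom-* t 2) ⟨
        ι (t ℕ.* 2) * ½      ≤⟨ *-monoˡ (nonNegative⁻¹ ½) (ι-mono-≤ t2≤T) ⟩
        ι T * ½              ∎)
      (upper-log-2^ T logn<x)
      where
      t2≤T : t ℕ.* 2 ℕ.≤ T
      t2≤T = ℕ.≤-trans (ℕ.≤-reflexive (ℕ.*-comm t 2))
               (ℕ.*-mono-≤ (ℕ.m≤m+n 2 22) (ℕ.≤-trans (ℕ.≤-reflexive (sym (ℕ.*-identityˡ t))) (ℕ.*-monoˡ-≤ t 1≤s)))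

    s/2<ℓ⁺ : ι s * ½ < ℓ⁺
    s/2<ℓ⁺ = 2^<compound⇒ s k₁ ∣ℓ⁺∣<N (<-trans (t<upper-log logn<p) p<e)

    -- 384 · (s/2) = 192 s, so that a · 192 s ≤ 1 when a ≥ 0.
    192s<u : ι 192 * ι s < u
    192s<u = ≤-<-trans (begin
        ι 192 * ι s          ≡⟨ solve 1 (λ s → con (ι 192) :* s := con (ι 384) :* (s :* con ½)) refl (ι s) ⟩
        ι 384 * (ι s * ½)    ≤⟨ *-mono (0≤ι 384) (<⇒≤ C<C⁺) (*-nonNeg (0≤ι s) (nonNegative⁻¹ ½)) (<⇒≤ s/2<ℓ⁺) ⟩
        C⁺ * ℓ⁺              ∎) C⁺ℓ⁺<u

    0≤t/8 : 0ℚ ≤ ι t * ⅛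
    0≤t/8 = *-nonNeg (0≤ι t) (nonNegative⁻¹ ⅛)

    -- A rational `a` below the reciprocal may be negative. For a ≥ 0 the constants combine as 24 s
    -- t = 192 s · t/8; for a ≤ 0 the product with the positive upper end `d` is at most 0.
    q≤t/8 : q ≤ ι t * ⅛
    q≤t/8 = either case-0≤a case-a≤0 (≤-total 0ℚ a)
      where
      case-0≤a : 0ℚ ≤ a → q ≤ ι t * ⅛
      case-0≤a 0≤a = begin
        q                                ≤⟨ <⇒≤ q<ac ⟩
        a * c                            ≤⟨ *-monoˡ-≤-nonNeg a {{nonNegative 0≤a}} (lower-log-2^ T c<logn) ⟩
        a * ι T                          ≡⟨ cong (a *_) (trans (ι-hom-* 24 (s ℕ.* t)) (cong (ι 24 *_) (ι-hom-* s t))) ⟩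
        a * (ι 24 * (ι s * ι t))         ≡⟨ solve 3 (λ a s t → a :* (con (ι 24) :* (s :* t))
                                                       := a :* (con (ι 192) :* s) :* (t :* con ⅛)) refl a (ι s) (ι t) ⟩
        a * (ι 192 * ι s) * (ι t * ⅛)    ≤⟨ *-monoˡ 0≤t/8 (≤-trans (*-monoˡ-≤-nonNeg a {{nonNegative 0≤a}} (<⇒≤ 192s<u)) (<⇒≤ au<1)) ⟩
        1ℚ * (ι t * ⅛)                   ≡⟨ *-identityˡ _ ⟩
        ι t * ⅛                          ∎
      case-a≤0 : a ≤ 0ℚ → q ≤ ι t * ⅛
      case-a≤0 a≤0 = begin
        q         ≤⟨ <⇒≤ q<ad ⟩
        a * d     ≤⟨ *-monoˡ (<⇒≤ (≤-<-trans (0≤ι t) (t<upper-log logn<d))) a≤0 ⟩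
        0ℚ * d    ≡⟨ *-zeroˡ d ⟩
        0ℚ        ≤⟨ 0≤t/8 ⟩
        ι t * ⅛   ∎

-- Chebyshev's lower bound for the number of primes, by beta integrals.

module ChebyshevBound where

  open import Data.Fin as Fin using (Fin)
  import Data.Fin.Properties as Fin
  open import Data.List using (List; []; _∷_; length; lookup; filter; upTo)
  open import Data.List.Membership.Propositional using (_∈_)
  open import Data.List.Membership.Propositional.Properties
    using (∈-filter⁺; ∈-filter⁻; ∈-lookup; ∈-upTo⁺; ∈-upTo⁻)
  open import Data.List.Relation.Unary.All as All using (All; []; _∷_)
  open import Data.List.Relation.Unary.AllPairs using (_∷_)
  open import Data.List.Relation.Unary.Any using (here; there)
  open import Data.List.Relation.Unary.Unique.Propositional using (Unique)
  import Data.List.Relation.Unary.Unique.Propositional.Properties as Unique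
  open import Data.Nat
  open import Data.Nat.DivMod using (_/_; m/n*n≡m)
  open import Data.Nat.Divisibility
  open import Data.Nat.Induction using (<-rec)
  open import Data.Nat.ListAction using (product)
  open import Data.Nat.Primality
  open import Data.Nat.Primality.Factorisation using (factorise)
  open import Data.Nat.Properties
  open import Data.Nat.Tactic.RingSolver using (solve-∀)
  open import Data.Product using (∃; ∃₂; _×_; _,_; proj₁; proj₂)
  open import Function using (_∘_)
  open import Relation.Binary.PropositionalEquality
    using (_≡_; refl; sym; trans; cong; cong₂; subst; module ≡-Reasoning)
  open import Relation.Nullary using (¬_; yes; no; contradiction)

  -- betaMultiple M i j = M ∫₀¹ xⁱ(1-x)ʲ dx whenever 1, …, i+j+1 all divide M.
  betaMultiple : ℕ → ℕ → ℕ → ℕ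
  betaMultiple M i zero    = M / suc i
  betaMultiple M i (suc j) = betaMultiple M i j ∸ betaMultiple M (suc i) j

  module _ {M L : ℕ} (divides-M : ∀ i → i < L → suc i ∣ M) where

    private J = betaMultiple M

    mutual
      -- The recurrence of the beta integral in the first exponent. For j = 0 both sides equal M;
      -- for j + 1, after multiplication by i + j + 2, they agree by `beta-sucʳ` at i + 1 and at i
      -- and by the recurrence for j.
      beta-sucˡ : ∀ i j → suc i + j < L → J (suc i) j * (i + j + 2) ≡ suc i * J i j
      beta-sucˡ i zero i+1<L = begin
        M / suc (suc i) * (i + 0 + 2)  ≡⟨ cong (M / suc (suc i) *_) (shift i) ⟩
        M / suc (suc i) * suc (suc i)  ≡⟨ m/n*n≡m (divides-M (suc i) (subst (_< L) (+-identityʳ (suc i)) i+1<L)) ⟩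
        M                              ≡⟨ m/n*n≡m (divides-M i (<-trans (n<1+n i) (subst (_< L) (+-identityʳ (suc i)) i+1<L))) ⟨
        M / suc i * suc i              ≡⟨ *-comm (M / suc i) (suc i) ⟩
        suc i * (M / suc i)            ∎
        where
        open ≡-Reasoning
        shift : ∀ i → i + 0 + 2 ≡ suc (suc i)
        shift = solve-∀
      beta-sucˡ i (suc j) bound = *-cancelˡ-≡ _ _ (suc (i + j + 1)) (begin
        suc (i + j + 1) * (J (suc i) (suc j) * (i + suc j + 2))     ≡⟨ cong₂ _*_ (shift₁ i j) (cong (J (suc i) (suc j) *_) (shift₂ i j)) ⟩
        (i + j + 2) * (J (suc i) (suc j) * (suc i + j + 2))         ≡⟨ cong ((i + j + 2) *_) (beta-sucʳ (suc i) j (subst (_< L) (+-suc (suc i) j) bound)) ⟩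
        (i + j + 2) * (suc j * J (suc i) j)                         ≡⟨ swap (i + j + 2) (suc j) (J (suc i) j) ⟩
        suc j * (J (suc i) j * (i + j + 2))                         ≡⟨ cong (suc j *_) (beta-sucˡ i j bound′) ⟩
        suc j * (suc i * J i j)                                     ≡⟨ swap′ (suc j) (suc i) (J i j) ⟩
        suc i * (suc j * J i j)                                     ≡⟨ cong (suc i *_) (beta-sucʳ i j bound′) ⟨
        suc i * (J i (suc j) * (i + j + 2))                         ≡⟨ rotate (suc i) (J i (suc j)) (i + j + 2) ⟩
        (i + j + 2) * (suc i * J i (suc j))                         ≡⟨ cong (_* (suc i * J i (suc j))) (shift₁ i j) ⟨
        suc (i + j + 1) * (suc i * J i (suc j))                     ∎)
        where
        open ≡-Reasoning
        bound′ : suc i + j < L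
        bound′ = <-trans (+-monoʳ-< (suc i) (n<1+n j)) bound
        shift₁ : ∀ i j → suc (i + j + 1) ≡ i + j + 2
        shift₁ = solve-∀
        shift₂ : ∀ i j → i + suc j + 2 ≡ suc i + j + 2
        shift₂ = solve-∀
        swap : ∀ a b c → a * (b * c) ≡ b * (c * a)
        swap = solve-∀
        rotate : ∀ a b c → a * (b * c) ≡ c * (a * b)
        rotate = solve-∀
        swap′ : ∀ a b c → a * (b * c) ≡ b * (a * c)
        swap′ = solve-∀

      -- After multiplication by i + j + 2 the truncated subtraction is exact: with x = `J i j`, it
      -- takes (i + 1) x from (i + 1) x + (j + 1) x.
      beta-sucʳ : ∀ i j → suc i + j < L → J i (suc j) * (i + j + 2) ≡ suc j * J i j
      beta-sucʳ i j bound = begin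
        (J i j ∸ J (suc i) j) * (i + j + 2)                ≡⟨ *-distribʳ-∸ (i + j + 2) (J i j) (J (suc i) j) ⟩
        J i j * (i + j + 2) ∸ J (suc i) j * (i + j + 2)    ≡⟨ cong₂ _∸_ (split (J i j) i j) (beta-sucˡ i j bound) ⟩
        suc i * J i j + suc j * J i j ∸ suc i * J i j      ≡⟨ m+n∸m≡n (suc i * J i j) _ ⟩
        suc j * J i j                                      ∎
        where
        open ≡-Reasoning
        split : ∀ x i j → x * (i + j + 2) ≡ suc i * x + suc j * x
        split = solve-∀

    -- A zero would propagate through `beta-sucʳ` down to M / (i + 1), which is positive because i +
    -- 1 divides M.
    beta-pos : 0 < M → ∀ i j → i + j < L → 0 < J i j
    beta-pos 0<M i zero i<L with J i zero in eq
    ... | suc _ = z<s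
    ... | zero  = contradiction 0<M (≤⇒≯ (≤-reflexive
                    (trans (sym (m/n*n≡m (divides-M i (subst (_< L) (+-identityʳ i) i<L)))) (cong (_* suc i) eq))))
    beta-pos 0<M i (suc j) bound with J i (suc j) in eq
    ... | suc _ = z<s
    ... | zero  = contradiction (*-mono-< (z<s {j}) (beta-pos 0<M i j (<-trans (+-monoʳ-< i (n<1+n j)) bound)))
                    (≤⇒≯ (≤-reflexive (trans (sym (beta-sucʳ i j (subst (_< L) (+-suc i j) bound)))
                                             (cong (_* (i + j + 2)) eq))))

    -- The counterpart of x(1 - x) ≤ 1/4: raising the first exponent from (m, m) halves the value
    -- exactly (`halve₁`), and raising the second then at least halves it again (`halve₂`).
    4^m*beta≤M : ∀ m → m + m < L → 4 ^ m * J m m ≤ M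
    4^m*beta≤M zero    bound = ≤-trans (≤-reflexive (*-identityˡ (M / 1)))
                                 (≤-reflexive (trans (sym (*-identityʳ (M / 1))) (m/n*n≡m (1∣ M))))
    4^m*beta≤M (suc m) bound = begin
      4 * 4 ^ m * J (suc m) (suc m)          ≡⟨ regroup (4 ^ m) (J (suc m) (suc m)) ⟩
      4 ^ m * (2 * (2 * J (suc m) (suc m)))  ≤⟨ *-monoʳ-≤ (4 ^ m) (*-monoʳ-≤ 2 halve₂) ⟩
      4 ^ m * (2 * J (suc m) m)              ≡⟨ cong (4 ^ m *_) halve₁ ⟩
      4 ^ m * J m m                          ≤⟨ 4^m*beta≤M m (<-trans (n<1+n _) (<-trans (n<1+n _) bound′)) ⟩
      M                                      ∎
      where
      open ≤-Reasoning
      bound′ : suc (suc m + m) < L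
      bound′ = subst (_< L) (cong suc (+-suc m m)) bound
      regroup : ∀ a b → 4 * a * b ≡ a * (2 * (2 * b))
      regroup = solve-∀
      double : ∀ m x → suc m * (2 * x) ≡ x * (m + m + 2)
      double = solve-∀
      halve₁ : 2 * J (suc m) m ≡ J m m
      halve₁ = *-cancelˡ-≡ _ _ (suc m) (trans (double m (J (suc m) m)) (beta-sucˡ m m (<-trans (n<1+n _) bound′)))
      halve₂ : 2 * J (suc m) (suc m) ≤ J (suc m) m
      halve₂ = *-cancelˡ-≤ (suc m) (≤-trans (≤-reflexive (double m (J (suc m) (suc m))))
        (≤-trans (*-monoʳ-≤ (J (suc m) (suc m)) (n≤1+n (m + m + 2))) (≤-reflexive (beta-sucʳ (suc m) m bound′))))

    -- M times the integral of (x(1 - x))^m is a positive integer, hence at least 1, and it is at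
    -- most M / 4^m.
    4^m≤M : 0 < M → ∀ m → m + m < L → 4 ^ m ≤ M
    4^m≤M 0<M m bound = ≤-trans (≤-trans (≤-reflexive (sym (*-identityʳ (4 ^ m))))
                                          (*-monoʳ-≤ (4 ^ m) (beta-pos 0<M m m bound)))
                                (4^m*beta≤M m bound)

  -- Common multiples of 1, ..., N built from prime powers.

  ^-monoʳ-∣ : ∀ p {d e} → d ≤ e → p ^ d ∣ p ^ e
  ^-monoʳ-∣ p {d} {e} d≤e = subst (p ^ d ∣_)
    (trans (sym (^-distribˡ-+-* p d (e ∸ d))) (cong (p ^_) (m+[n∸m]≡n d≤e))) (m∣m*n (p ^ (e ∸ d)))

  n<2^n : ∀ n → n < 2 ^ n
  n<2^n zero    = z<s
  n<2^n (suc n) = ≤-trans (s≤s (n<2^n n))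
    (≤-trans (+-monoˡ-≤ (2 ^ n) (m^n>0 2 n)) (≤-reflexive (cong (2 ^ n +_) (sym (+-identityʳ (2 ^ n))))))

  -- For prime `p` this is its power in lcm(1, ..., N). Any e with p^e ≤ N has e < 2^e ≤ p^e ≤ N, so
  -- a search over exponents up to N misses none.
  greatestPower : ∀ p N → 1 < p → 0 < N → ∃ λ P → 0 < P × P ≤ N × (∀ e → p ^ e ≤ N → p ^ e ∣ P)
  greatestPower p N 1<p 0<N =
    let P , 0<P , P≤N , div = go N in
    P , 0<P , P≤N , λ e pᵉ≤N → div e (<⇒≤ (<-≤-trans (n<2^n e) (≤-trans (^-monoˡ-≤ e 1<p) pᵉ≤N))) pᵉ≤N
    where
    instance _ = >-nonZero (<-trans z<s 1<p)
    go : ∀ b → ∃ λ P → 0 < P × P ≤ N × (∀ e → e ≤ b → p ^ e ≤ N → p ^ e ∣ P)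
    go zero    = 1 , z<s , 0<N , λ { zero z≤n _ → ∣-refl }
    go (suc b) with p ^ suc b ≤? N
    ... | yes le = p ^ suc b , m^n>0 p (suc b) , le , λ e e≤b _ → ^-monoʳ-∣ p e≤b
    ... | no nle =
      let P , 0<P , P≤N , div = go b in
      P , 0<P , P≤N , λ e e≤1+b pᵉ≤N → div e (≤-pred (≤∧≢⇒< e≤1+b (λ { refl → nle pᵉ≤N }))) pᵉ≤N

  extractPower : ∀ p → 1 < p → ∀ j → 0 < j → ∃₂ λ e k → j ≡ p ^ e * k × ¬ (p ∣ k)
  extractPower p 1<p = <-rec _ go
    where
    go : ∀ j → (∀ {i} → i < j → 0 < i → ∃₂ λ e k → i ≡ p ^ e * k × ¬ (p ∣ k)) →
         0 < j → ∃₂ λ e k → j ≡ p ^ e * k × ¬ (p ∣ k)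
    go j rec 0<j with p ∣? j
    ... | no p∤j = 0 , j , sym (*-identityˡ j) , p∤j
    ... | yes (divides zero refl) = contradiction 0<j (<-irrefl refl)
    ... | yes (divides q@(suc _) refl) =
      let e , k , q≡ , p∤k = rec (m<m*n q p 1<p) z<s in
      suc e , k , trans (*-comm q p) (trans (cong (p *_) q≡) (sym (*-assoc p (p ^ e) k))) , p∤k

  0<prime : ∀ {p} → Prime p → 0 < p
  0<prime p-prime = >-nonZero⁻¹ _ {{prime⇒nonZero p-prime}}

  1<prime : ∀ {p} → Prime p → 1 < p
  1<prime p-prime = nonTrivial⇒n>1 _ {{prime⇒nonTrivial p-prime}}

  noPrimeDivisor⇒≡1 : ∀ j → 0 < j → (∀ p → Prime p → ¬ (p ∣ j)) → j ≡ 1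
  noPrimeDivisor⇒≡1 j 0<j none with factorise j {{>-nonZero 0<j}}
  ... | record { factors = []     ; isFactorisation = j≡1 } = j≡1
  ... | record { factors = p ∷ ps ; isFactorisation = refl ; factorsPrime = p-prime ∷ _ } =
    contradiction (m∣m*n (product ps)) (none p p-prime)

  -- `M` is the product of the greatest powers up to N of the listed primes, so each prime costs a
  -- factor of at most N. Writing j = p^e k with k prime to p, p^e divides the first factor and, by
  -- induction, k divides the rest.
  smoothMultiple : ∀ N → 0 < N → ∀ ps → All Prime ps → ∃ λ M → 0 < M × M ≤ N ^ length ps ×
    (∀ j → 0 < j → j ≤ N → (∀ p → Prime p → p ∣ j → p ∈ ps) → j ∣ M)
  smoothMultiple N 0<N []       []                   = 1 , z<s , ≤-refl , λ j 0<j _ smooth →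
    ∣-reflexive (noPrimeDivisor⇒≡1 j 0<j λ p p-prime p∣j → contradiction (smooth p p-prime p∣j) λ ())
  smoothMultiple N 0<N (p ∷ ps) (p-prime ∷ ps-prime) =
    let P , 0<P , P≤N , pᵉ∣P = greatestPower p N (1<prime p-prime) 0<N
        M , 0<M , M≤N^ , div = smoothMultiple N 0<N ps ps-prime
    in P * M , *-mono-< 0<P 0<M , *-mono-≤ P≤N M≤N^ , λ j 0<j j≤N smooth →
      let e , k , j≡ , p∤k = extractPower p (1<prime p-prime) j 0<j
          k∣j = subst (k ∣_) (sym j≡) (n∣m*n (p ^ e))
          pᵉ∣j = subst (p ^ e ∣_) (sym j≡) (m∣m*n k)
          instance _ = >-nonZero 0<j
          k-smooth : ∀ q → Prime q → q ∣ k → q ∈ ps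
          k-smooth q q-prime q∣k = tail q∣k p∤k (smooth q q-prime (∣-trans q∣k k∣j))
      in subst (_∣ P * M) (sym j≡)
           (*-pres-∣ (pᵉ∣P e (≤-trans (∣⇒≤ pᵉ∣j) j≤N))
                     (div k (n≢0⇒n>0 λ k≡0 → p∤k (subst (p ∣_) (sym k≡0) (p ∣0))) (≤-trans (∣⇒≤ k∣j) j≤N) k-smooth))
    where
    tail : ∀ {q k} → q ∣ k → ¬ (p ∣ k) → q ∈ p ∷ ps → q ∈ ps
    tail q∣k p∤k (here refl) = contradiction q∣k p∤k
    tail q∣k p∤k (there q∈ps) = q∈ps

  primesUpTo : ℕ → List ℕ
  primesUpTo N = filter prime? (upTo (suc N))

  primesUpTo-prime : ∀ N {p} → p ∈ primesUpTo N → Prime p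
  primesUpTo-prime N = proj₂ ∘ ∈-filter⁻ prime? {xs = upTo (suc N)}

  primesUpTo-≤ : ∀ N {p} → p ∈ primesUpTo N → p ≤ N
  primesUpTo-≤ N = ≤-pred ∘ ∈-upTo⁻ ∘ proj₁ ∘ ∈-filter⁻ prime? {xs = upTo (suc N)}

  -- The prime divisors of any j ≤ N are among the primes up to N, so `smoothMultiple` gives a
  -- common multiple of 1, ..., N that is at most N^π.
  4^m≤N^π : ∀ N m → m + m < N → 4 ^ m ≤ N ^ length (primesUpTo N)
  4^m≤N^π N m 2m<N =
    let M , 0<M , M≤N^ , div = smoothMultiple N (≤-<-trans z≤n 2m<N) (primesUpTo N) (All.tabulate (primesUpTo-prime N))
    in ≤-trans (4^m≤M (λ i i<N → div (suc i) z<s i<N λ p p-prime p∣i →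
                  ∈-filter⁺ prime? (∈-upTo⁺ (s≤s (≤-trans (∣⇒≤ p∣i) i<N))) p-prime) 0<M m 2m<N) M≤N^

  2^-cancel-≤ : ∀ {d e} → 2 ^ d ≤ 2 ^ e → d ≤ e
  2^-cancel-≤ {d} {e} h with d ≤? e
  ... | yes d≤e = d≤e
  ... | no  d≰e = contradiction h (<⇒≱ (^-monoʳ-< 2 (s≤s (s≤s z≤n)) (≰⇒> d≰e)))

  -- For N = 2^(8s) the bound 4^m ≤ N^π compares exponents of 2, giving 2m ≤ 8 s π; it remains to
  -- check N - 2 ≥ 48 s 2^s.
  6*2^s≤π : ∀ s → 1 ≤ s → 6 * 2 ^ s ≤ length (primesUpTo (2 ^ (8 * s)))
  6*2^s≤π s@(suc s-1) 1≤s = *-cancelˡ-≤ (8 * s) (begin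
    8 * s * (6 * 2 ^ s)      ≤⟨ +-cancelˡ-≤ 1 _ _ (+-cancelˡ-≤ 1 _ _ enough) ⟩
    m + m                    ≡⟨ cong (m +_) (+-identityʳ m) ⟨
    2 * m                    ≤⟨ 2^-cancel-≤ (begin
        2 ^ (2 * m)          ≡⟨ ^-*-assoc 2 2 m ⟨
        4 ^ m                ≤⟨ 4^m≤N^π N m (≤-trans (n≤1+n _) (≤-reflexive 2+2m≡N)) ⟩
        N ^ π                ≡⟨ ^-*-assoc 2 (8 * s) π ⟩
        2 ^ (8 * s * π)      ∎) ⟩
    8 * s * π                ∎)
    where
    open ≤-Reasoning
    N = 2 ^ (8 * s)
    π = length (primesUpTo N)
    -- The largest m with 2m < N: as N is even, 2m + 2 = N.
    m = pred (2 ^ pred (8 * s))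
    instance _ = m^n≢0 2 (pred (8 * s))
    2+2m≡N : 2 + (m + m) ≡ N
    2+2m≡N = trans (double m) (cong (2 *_) (suc-pred (2 ^ pred (8 * s))))
      where
      double : ∀ m → 2 + (m + m) ≡ 2 * suc m
      double = solve-∀
    enough : 2 + 8 * s * (6 * 2 ^ s) ≤ 2 + (m + m)
    enough = begin
      2 + 8 * s * (6 * 2 ^ s)              ≡⟨ cong (2 +_) (lemma₁ s (2 ^ s)) ⟩
      -- The 2 is absorbed by raising 48 to 50. Then 50 ≤ 64^s and s ≤ 2^s, and 64^s · 2^s · 2^s is
      -- exactly 2^(8s).
      2 + 48 * (s * 2 ^ s)                 ≤⟨ +-monoˡ-≤ _ (*-monoʳ-≤ 2 (*-mono-≤ 1≤s (m^n>0 2 s))) ⟩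
      2 * (s * 2 ^ s) + 48 * (s * 2 ^ s)   ≡⟨ *-distribʳ-+ (s * 2 ^ s) 2 48 ⟨
      50 * (s * 2 ^ s)                     ≤⟨ *-mono-≤ 50≤64^s (*-monoˡ-≤ (2 ^ s) (<⇒≤ (n<2^n s))) ⟩
      64 ^ s * (2 ^ s * 2 ^ s)             ≡⟨ cong₂ _*_ (^-*-assoc 2 6 s) (sym (^-distribˡ-+-* 2 s s)) ⟩
      2 ^ (6 * s) * 2 ^ (s + s)            ≡⟨ ^-distribˡ-+-* 2 (6 * s) (s + s) ⟨
      2 ^ (6 * s + (s + s))                ≡⟨ cong (2 ^_) (lemma₂ s) ⟩
      N                                    ≡⟨ 2+2m≡N ⟨
      2 + (m + m)                          ∎
      where
      lemma₁ : ∀ a b → 8 * a * (6 * b) ≡ 48 * (a * b)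
      lemma₁ = solve-∀
      lemma₂ : ∀ a → 6 * a + (a + a) ≡ 8 * a
      lemma₂ = solve-∀
      50≤64^s : 50 ≤ 64 ^ s
      50≤64^s = ≤-trans (m≤m+n 50 14) (^-monoʳ-≤ 64 {1} {s} 1≤s)

  lookup-injective : ∀ {a} {A : Set a} {xs : List A} → Unique xs → ∀ i j → lookup xs i ≡ lookup xs j → i ≡ j
  lookup-injective (_  ∷ _)  Fin.zero    Fin.zero    _  = refl
  lookup-injective (x∉ ∷ _)  Fin.zero    (Fin.suc j) eq = contradiction eq (All.lookup x∉ (∈-lookup j))
  lookup-injective (x∉ ∷ _)  (Fin.suc i) Fin.zero    eq = contradiction (sym eq) (All.lookup x∉ (∈-lookup i))
  lookup-injective (_  ∷ un) (Fin.suc i) (Fin.suc j) eq = cong Fin.suc (lookup-injective un i j eq)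

  -- With k = 6, row `j` belongs to the j-th copy of the four-point set and column `c` to its c-th
  -- pair.
  record PrimeTable (t k N : ℕ) : Set where
    field
      entry     : Fin t → Fin k → ℕ
      isPrime   : ∀ j c → Prime (entry j c)
      bounded   : ∀ j c → entry j c ≤ N
      injective : ∀ {j c j′ c′} → entry j c ≡ entry j′ c′ → j ≡ j′ × c ≡ c′

  primeTable : ∀ s → 1 ≤ s → PrimeTable (2 ^ s) 6 (2 ^ (8 * s))
  primeTable s 1≤s = record
    { entry     = λ j c → lookup ps (index j c)
    ; isPrime   = λ j c → primesUpTo-prime N (∈-lookup (index j c))
    ; bounded   = λ j c → primesUpTo-≤ N (∈-lookup (index j c))
    ; injective = λ {j} {c} {j′} {c′} eq → Fin.combine-injective j c j′ c′
        (Fin.inject≤-injective _ _ _ _ (lookup-injective (Unique.filter⁺ prime? (Unique.upTo⁺ (suc N))) _ _ eq))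
    }
    where
    N = 2 ^ (8 * s)
    ps = primesUpTo N
    index : Fin (2 ^ s) → Fin 6 → Fin (length ps)
    index j c = Fin.inject≤ (Fin.combine j c) (≤-trans (≤-reflexive (*-comm (2 ^ s) 6)) (6*2^s≤π s 1≤s))

-- Sums of functions on {0,1,2,3}ᵗ over boxes.

module BoxSums where

  open Powers
  open import Data.Bool using (true; false; if_then_else_; _∧_)
  open import Data.Fin as Fin using (Fin; zero; suc)
  open import Data.Fin.Patterns using (0F; 1F; 2F; 3F; 4F; 5F)
  import Data.Fin.Properties as Fin
  open import Data.Integer hiding (suc)
  open import Data.Integer.Properties
  open import Data.Integer.Tactic.RingSolver using (solve-∀)
  open import Data.List using (List; []; _∷_)
  import Data.List.Membership.DecPropositional as DecMembership
  open import Data.List.Membership.Propositional using (_∈_)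
  open import Data.Nat as ℕ using (ℕ; zero; suc)
  open import Data.Product using (∃; _,_)
  open import Data.Sum using (inj₁; inj₂)
  open import Data.Vec using (Vec; []; _∷_)
  open import Data.Vec.Relation.Binary.Pointwise.Inductive as Pointwise using (Pointwise)
  open import Function using (_∘_)
  open import Relation.Binary.PropositionalEquality
    using (_≡_; _≢_; _≗_; refl; sym; trans; cong; subst; subst₂; module ≡-Reasoning)
  open import Relation.Nullary using (¬_; Dec; yes; no; does)
  open import Relation.Nullary.Decidable using (map′; dec-true; dec-false)
  open import Relation.Unary using (Decidable)

  open import Algebra.Properties.Semiring.Sum +-*-semiring
    using (sum; sum-cong-≗; sum-replicate-zero; ∑-comm; *-distribˡ-sum)

  sum-zero : ∀ {n} {h : Fin n → ℤ} → (∀ i → h i ≡ 0ℤ) → sum h ≡ 0ℤ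
  sum-zero {n} h≡0 = trans (sum-cong-≗ h≡0) (sum-replicate-zero n)

  sum-single : ∀ {n} {h : Fin n → ℤ} i → (∀ j → j ≢ i → h j ≡ 0ℤ) → sum h ≡ h i
  sum-single {h = h} zero    h≡0 = trans (cong (λ z → h zero + z) (sum-zero λ j → h≡0 (suc j) λ ())) (+-identityʳ (h zero))
  sum-single {h = h} (suc i) h≡0 = trans (cong (_+ sum (h ∘ suc)) (h≡0 zero λ ())) (trans (+-identityˡ _)
    (sum-single i λ j j≢i → h≡0 (suc j) (j≢i ∘ Fin.suc-injective)))

  sum-mono : ∀ {n} {g h : Fin n → ℤ} → (∀ i → g i ≤ h i) → sum g ≤ sum h
  sum-mono {zero}  g≤h = ≤-refl
  sum-mono {suc n} g≤h = +-mono-≤ (g≤h zero) (sum-mono (g≤h ∘ suc))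

  sumᵛ : ∀ {k} t → (Vec (Fin k) t → ℤ) → ℤ
  sumᵛ zero    F = F []
  sumᵛ (suc t) F = sum λ i → sumᵛ t λ x → F (i ∷ x)

  sumᵛ-cong : ∀ {k} t {F G : Vec (Fin k) t → ℤ} → F ≗ G → sumᵛ t F ≡ sumᵛ t G
  sumᵛ-cong zero    F≗G = F≗G []
  sumᵛ-cong (suc t) F≗G = sum-cong-≗ λ i → sumᵛ-cong t λ x → F≗G (i ∷ x)

  sumᵛ-mono : ∀ {k} t {F G : Vec (Fin k) t → ℤ} → (∀ x → F x ≤ G x) → sumᵛ t F ≤ sumᵛ t G
  sumᵛ-mono zero    F≤G = F≤G []
  sumᵛ-mono (suc t) F≤G = sum-mono λ i → sumᵛ-mono t λ x → F≤G (i ∷ x)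

  sumᵛ-zero : ∀ {k} t {F : Vec (Fin k) t → ℤ} → (∀ x → F x ≡ 0ℤ) → sumᵛ t F ≡ 0ℤ
  sumᵛ-zero zero    F≡0 = F≡0 []
  sumᵛ-zero (suc t) F≡0 = sum-zero λ i → sumᵛ-zero t λ x → F≡0 (i ∷ x)

  sumᵛ-single : ∀ {k} t {F : Vec (Fin k) t → ℤ} y → (∀ x → x ≢ y → F x ≡ 0ℤ) → sumᵛ t F ≡ F y
  sumᵛ-single zero    []      F≡0 = refl
  sumᵛ-single (suc t) (i ∷ y) F≡0 = trans
    (sum-single i λ j j≢i → sumᵛ-zero t λ x → F≡0 (j ∷ x) λ { refl → j≢i refl })
    (sumᵛ-single t y λ x x≢y → F≡0 (i ∷ x) λ { refl → x≢y refl })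

  sum-sumᵛ-comm : ∀ {k n} t (F : Fin n → Vec (Fin k) t → ℤ) →
                  sum (λ i → sumᵛ t (F i)) ≡ sumᵛ t λ x → sum λ i → F i x
  sum-sumᵛ-comm zero    F = refl
  sum-sumᵛ-comm (suc t) F = trans (∑-comm λ i j → sumᵛ t λ x → F i (j ∷ x))
                                  (sum-cong-≗ λ j → sum-sumᵛ-comm t λ i x → F i (j ∷ x))

  *-distribˡ-sumᵛ : ∀ {k} c t (F : Vec (Fin k) t → ℤ) → c * sumᵛ t F ≡ sumᵛ t λ x → c * F x
  *-distribˡ-sumᵛ c zero    F = refl
  *-distribˡ-sumᵛ c (suc t) F = trans (*-distribˡ-sum c λ i → sumᵛ t λ x → F (i ∷ x))
                                      (sum-cong-≗ λ i → *-distribˡ-sumᵛ c t λ x → F (i ∷ x))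

  sum-one : ∀ n → sum {n} (λ _ → 1ℤ) ≡ + n
  sum-one zero    = refl
  sum-one (suc n) = cong (λ z → 1ℤ + z) (sum-one n)

  sumᵛ-one : ∀ k t → sumᵛ {k} t (λ _ → 1ℤ) ≡ + (k ℕ.^ t)
  sumᵛ-one k zero    = refl
  sumᵛ-one k (suc t) = begin
    sum {k} (λ _ → sumᵛ {k} t (λ _ → 1ℤ))  ≡⟨ sum-cong-≗ {k} (λ _ → trans (sumᵛ-one k t) (sym (*-identityʳ (+ (k ℕ.^ t))))) ⟩
    sum {k} (λ _ → + (k ℕ.^ t) * 1ℤ)       ≡⟨ *-distribˡ-sum {k} (+ (k ℕ.^ t)) (λ _ → 1ℤ) ⟨
    + (k ℕ.^ t) * sum {k} (λ _ → 1ℤ)       ≡⟨ cong (+ (k ℕ.^ t) *_) (sum-one k) ⟩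
    + (k ℕ.^ t) * + k                      ≡⟨ *-comm (+ (k ℕ.^ t)) (+ k) ⟩
    + k * + (k ℕ.^ t)                      ≡⟨ pos-* k (k ℕ.^ t) ⟨
    + (k ℕ.^ suc t)                        ∎
    where open ≡-Reasoning

  max-index : ∀ {k} (h : Fin (suc k) → ℤ) → ∃ λ i → ∀ j → h j ≤ h i
  max-index {zero}  h = zero , λ { zero → ≤-refl }
  max-index {suc k} h with max-index (h ∘ suc)
  ... | i , hi-max with ≤-total (h zero) (h (suc i))
  ...   | inj₁ le = suc i , λ { zero → le ; (suc j) → hi-max j }
  ...   | inj₂ ge = zero  , λ { zero → ≤-refl ; (suc j) → ≤-trans (hi-max j) ge }

  max-indexᵛ : ∀ {k} t (F : Vec (Fin (suc k)) t → ℤ) → ∃ λ y → ∀ x → F x ≤ F y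
  max-indexᵛ zero    F = [] , λ { [] → ≤-refl }
  max-indexᵛ {k} (suc t) F with max-index (λ i → F (i ∷ best i))
    where
    best : Fin (suc k) → Vec (Fin (suc k)) t
    best i = let y , _ = max-indexᵛ t (λ x → F (i ∷ x)) in y
  ... | i , max = _ , λ { (j ∷ x) → let _ , le = max-indexᵛ t (λ x → F (j ∷ x)) in ≤-trans (le x) (max j) }

  sumᵛ≤k^t*max : ∀ {k} t (F : Vec (Fin (suc k)) t → ℤ) → ∃ λ y → sumᵛ t F ≤ + (suc k ℕ.^ t) * F y
  sumᵛ≤k^t*max {k} t F with max-indexᵛ t F
  ... | y , F≤Fy = y , (begin
    sumᵛ t F                      ≤⟨ sumᵛ-mono t F≤Fy ⟩
    sumᵛ t (λ _ → F y)            ≡⟨ sumᵛ-cong t (λ _ → sym (*-identityʳ (F y))) ⟩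
    sumᵛ t (λ _ → F y * 1ℤ)       ≡⟨ *-distribˡ-sumᵛ (F y) t (λ _ → 1ℤ) ⟨
    F y * sumᵛ t (λ _ → 1ℤ)       ≡⟨ cong (F y *_) (sumᵛ-one (suc k) t) ⟩
    F y * + (suc k ℕ.^ t)         ≡⟨ *-comm (F y) _ ⟩
    + (suc k ℕ.^ t) * F y         ∎)
    where open ≤-Reasoning

  -- Makes the image of a map on vectors decidable, which defines the set of numbers later.
  any?ᵛ : ∀ {k} t {P : Vec (Fin k) t → Set} → Decidable P → Dec (∃ P)
  any?ᵛ zero    P? = map′ (λ p → [] , p) (λ { ([] , p) → p }) (P? [])
  any?ᵛ (suc t) P? = map′ (λ { (i , x , p) → i ∷ x , p }) (λ { (i ∷ x , p) → i , x , p })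
    (Fin.any? λ i → any?ᵛ t λ x → P? (i ∷ x))

  -- Each `F i` is spread over the x with `pos x` = i: by injectivity one term for i in the image,
  -- and none otherwise, where `F i` is 0. Exchanging the sums then leaves one term for each x.
  sum-image : ∀ {k n} t (pos : Vec (Fin k) t → Fin n) → (∀ {x y} → pos x ≡ pos y → x ≡ y) →
              (F : Fin n → ℤ) → (∀ i → ¬ (∃ λ x → pos x ≡ i) → F i ≡ 0ℤ) → sum F ≡ sumᵛ t (F ∘ pos)
  sum-image {n = n} t pos pos-injective F F≡0 = begin
    sum F                                   ≡⟨ sum-cong-≗ spread ⟩
    sum (λ i → sumᵛ t λ x → at i x)         ≡⟨ sum-sumᵛ-comm t at ⟩
    sumᵛ t (λ x → sum λ i → at i x)         ≡⟨ sumᵛ-cong t collect ⟩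
    sumᵛ t (F ∘ pos)                        ∎
    where
    open ≡-Reasoning
    at : Fin n → Vec (Fin _) t → ℤ
    at i x = if does (pos x Fin.≟ i) then F i else 0ℤ
    at-≡ : ∀ {i x} → pos x ≡ i → at i x ≡ F i
    at-≡ {i} {x} eq = cong (if_then F i else 0ℤ) (dec-true (pos x Fin.≟ i) eq)
    at-≢ : ∀ {i x} → pos x ≢ i → at i x ≡ 0ℤ
    at-≢ {i} {x} neq = cong (if_then F i else 0ℤ) (dec-false (pos x Fin.≟ i) neq)
    collect : ∀ x → sum (λ i → at i x) ≡ F (pos x)
    collect x = trans (sum-single (pos x) λ i i≢ → at-≢ (i≢ ∘ sym)) (at-≡ refl)
    spread : ∀ i → F i ≡ sumᵛ t (at i)
    spread i with any?ᵛ t (λ x → pos x Fin.≟ i)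
    ... | yes (y , refl) = sym (trans (sumᵛ-single t y λ x x≢y → at-≢ (x≢y ∘ pos-injective)) (at-≡ refl))
    ... | no  none       = trans (F≡0 i none) (sym (sumᵛ-zero t λ x → at-≢ λ eq → none (x , eq)))

  -- Fin 6 numbers the pairs {0,1}, {0,2}, {0,3}, {1,2}, {1,3}, {2,3} of points of Fin 4.
  pairsThrough : Fin 4 → List (Fin 6)
  pairsThrough 0F = 0F ∷ 1F ∷ 2F ∷ []
  pairsThrough 1F = 0F ∷ 3F ∷ 4F ∷ []
  pairsThrough 2F = 1F ∷ 3F ∷ 5F ∷ []
  pairsThrough 3F = 2F ∷ 4F ∷ 5F ∷ []

  _∈ᵖ_ : Fin 4 → Fin 6 → Set
  i ∈ᵖ c = c ∈ pairsThrough i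

  _∈ᵖ?_ : ∀ i c → Dec (i ∈ᵖ c)
  i ∈ᵖ? c = DecMembership._∈?_ Fin._≟_ c (pairsThrough i)

  _∈ᵇ_ : ∀ {t} → Vec (Fin 4) t → Vec (Fin 6) t → Set
  _∈ᵇ_ = Pointwise _∈ᵖ_

  _∈ᵇ?_ : ∀ {t} (x : Vec (Fin 4) t) P → Dec (x ∈ᵇ P)
  _∈ᵇ?_ = Pointwise.decidable _∈ᵖ?_

  boxSum : ∀ {t} → (Vec (Fin 4) t → ℤ) → Vec (Fin 6) t → ℤ
  boxSum {t} G P = sumᵛ t λ x → if does (x ∈ᵇ? P) then G x else 0ℤ

  0≤i² : ∀ i → 0ℤ ≤ i * i
  0≤i² (+ n)    = subst (0ℤ ≤_) (pos-* n n) (+≤+ ℕ.z≤n)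
  0≤i² -[1+ n ] = +≤+ ℕ.z≤n

  pairs-inequality : ∀ (h : Fin 4 → ℤ) → + 2 * sum (λ i → h i * h i) ≤
    sum λ c → let s = sum (λ i → if does (i ∈ᵖ? c) then h i else 0ℤ) in s * s
  pairs-inequality h = subst₂ _≤_ (+-identityʳ _) (identity (h 0F) (h 1F) (h 2F) (h 3F))
    (+-monoʳ-≤ (+ 2 * sum (λ i → h i * h i)) (0≤i² (sum h)))
    where
    -- The nesting and the zeros are those to which `sum` and the tests `i ∈ᵖ? c` reduce, one
    -- product per pair, so the ring identity fits without rewriting.
    identity : ∀ a b c d →
      + 2 * (a * a + (b * b + (c * c + (d * d + 0ℤ)))) + (a + (b + (c + (d + 0ℤ)))) * (a + (b + (c + (d + 0ℤ)))) ≡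
      (a + (b + (0ℤ + (0ℤ + 0ℤ)))) * (a + (b + (0ℤ + (0ℤ + 0ℤ)))) +
      ((a + (0ℤ + (c + (0ℤ + 0ℤ)))) * (a + (0ℤ + (c + (0ℤ + 0ℤ)))) +
      ((a + (0ℤ + (0ℤ + (d + 0ℤ)))) * (a + (0ℤ + (0ℤ + (d + 0ℤ)))) +
      ((0ℤ + (b + (c + (0ℤ + 0ℤ)))) * (0ℤ + (b + (c + (0ℤ + 0ℤ)))) +
      ((0ℤ + (b + (0ℤ + (d + 0ℤ)))) * (0ℤ + (b + (0ℤ + (d + 0ℤ)))) +
      ((0ℤ + (0ℤ + (c + (d + 0ℤ)))) * (0ℤ + (0ℤ + (c + (d + 0ℤ)))) + 0ℤ)))))
    identity = solve-∀

  -- The test of `i ∷ x` against `c ∷ P` reduces to a conjunction. If i misses c the inner sum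
  -- vanishes; otherwise it is a box sum in one dimension less.
  boxSum-∷ : ∀ {t} (G : Vec (Fin 4) (suc t) → ℤ) c P →
    boxSum G (c ∷ P) ≡ sum λ i → if does (i ∈ᵖ? c) then boxSum (λ x → G (i ∷ x)) P else 0ℤ
  boxSum-∷ {t} G c P = sum-cong-≗ λ i → pull (does (i ∈ᵖ? c)) i
    where
    pull : ∀ b i → sumᵛ t (λ x → if b ∧ does (x ∈ᵇ? P) then G (i ∷ x) else 0ℤ) ≡
                   (if b then boxSum (λ x → G (i ∷ x)) P else 0ℤ)
    pull true  i = refl
    pull false i = sumᵛ-zero t λ _ → refl

  -- Tensorisation by slicing along the first coordinate: the induction hypothesis for each of the
  -- four slices, then `pairs-inequality` for the slice sums `H P i` with P fixed.
  boxes-inequality : ∀ t (G : Vec (Fin 4) t → ℤ) →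
    + (2 ℕ.^ t) * sumᵛ t (λ x → G x * G x) ≤ sumᵛ t λ P → boxSum G P * boxSum G P
  boxes-inequality zero    G = ≤-reflexive (*-identityˡ (G [] * G []))
  boxes-inequality (suc t) G = begin
    + (2 ℕ.^ suc t) * sum (λ i → sumᵛ t λ x → G (i ∷ x) * G (i ∷ x))
      ≡⟨ cong (_* sum (λ i → sumᵛ t λ x → G (i ∷ x) * G (i ∷ x))) (pos-* 2 (2 ℕ.^ t)) ⟩
    + 2 * + (2 ℕ.^ t) * sum (λ i → sumᵛ t λ x → G (i ∷ x) * G (i ∷ x))
      ≡⟨ *-assoc (+ 2) (+ (2 ℕ.^ t)) _ ⟩
    + 2 * (+ (2 ℕ.^ t) * sum (λ i → sumᵛ t λ x → G (i ∷ x) * G (i ∷ x)))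
      ≡⟨ cong (+ 2 *_) (*-distribˡ-sum (+ (2 ℕ.^ t)) (λ i → sumᵛ t λ x → G (i ∷ x) * G (i ∷ x))) ⟩
    + 2 * sum (λ i → + (2 ℕ.^ t) * sumᵛ t λ x → G (i ∷ x) * G (i ∷ x))
      ≤⟨ *-monoˡ-≤-nonNeg (+ 2) (sum-mono λ i → boxes-inequality t (λ x → G (i ∷ x))) ⟩
    + 2 * sum (λ i → sumᵛ t λ P → H P i * H P i)
      ≡⟨ cong (+ 2 *_) (sum-sumᵛ-comm t (λ i P → H P i * H P i)) ⟩
    + 2 * sumᵛ t (λ P → sum λ i → H P i * H P i)
      ≡⟨ *-distribˡ-sumᵛ (+ 2) t (λ P → sum λ i → H P i * H P i) ⟩
    sumᵛ t (λ P → + 2 * sum λ i → H P i * H P i)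
      ≤⟨ sumᵛ-mono t (λ P → pairs-inequality (H P)) ⟩
    sumᵛ t (λ P → sum λ c → let s = sum (λ i → if does (i ∈ᵖ? c) then H P i else 0ℤ) in s * s)
      ≡⟨ sumᵛ-cong t (λ P → sum-cong-≗ λ c → cong (λ s → s * s) (boxSum-∷ G c P)) ⟨
    sumᵛ t (λ P → sum λ c → boxSum G (c ∷ P) * boxSum G (c ∷ P))
      ≡⟨ sum-sumᵛ-comm t (λ c P → boxSum G (c ∷ P) * boxSum G (c ∷ P)) ⟨
    sum (λ c → sumᵛ t λ P → boxSum G (c ∷ P) * boxSum G (c ∷ P)) ∎
    where
    open ≤-Reasoning
    H : Vec (Fin 6) t → Fin 4 → ℤ
    H P i = boxSum (λ x → G (i ∷ x)) P

  i*i≡∣i∣*∣i∣ : ∀ i → i * i ≡ + (∣ i ∣ ℕ.* ∣ i ∣)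
  i*i≡∣i∣*∣i∣ (+ n)    = sym (pos-* n n)
  i*i≡∣i∣*∣i∣ -[1+ n ] = refl

  -- As G² = 1, the left side of `boxes-inequality` is 2ᵗ · 4ᵗ = 8ᵗ, and the largest of the 6ᵗ
  -- squares is at least their average.
  large-boxSum : ∀ t (G : Vec (Fin 4) t → ℤ) → (∀ x → G x * G x ≡ 1ℤ) →
    ∃ λ P → 8 ℕ.^ t ℕ.≤ 6 ℕ.^ t ℕ.* (∣ boxSum G P ∣ ℕ.* ∣ boxSum G P ∣)
  large-boxSum t G G²≡1 with sumᵛ≤k^t*max t (λ P → boxSum G P * boxSum G P)
  ... | P , le = P , drop‿+≤+ (begin
    + (8 ℕ.^ t)                                          ≡⟨ cong +_ (^-distribʳ-* 2 4 t) ⟩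
    + (2 ℕ.^ t ℕ.* 4 ℕ.^ t)                              ≡⟨ pos-* (2 ℕ.^ t) (4 ℕ.^ t) ⟩
    + (2 ℕ.^ t) * + (4 ℕ.^ t)                            ≡⟨ cong (+ (2 ℕ.^ t) *_) (trans (sumᵛ-cong t G²≡1) (sumᵛ-one 4 t)) ⟨
    + (2 ℕ.^ t) * sumᵛ t (λ x → G x * G x)               ≤⟨ boxes-inequality t G ⟩
    sumᵛ t (λ P → boxSum G P * boxSum G P)               ≤⟨ le ⟩
    + (6 ℕ.^ t) * (boxSum G P * boxSum G P)              ≡⟨ cong (+ (6 ℕ.^ t) *_) (i*i≡∣i∣*∣i∣ (boxSum G P)) ⟩
    + (6 ℕ.^ t) * + (∣ boxSum G P ∣ ℕ.* ∣ boxSum G P ∣)  ≡⟨ pos-* (6 ℕ.^ t) _ ⟨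
    + (6 ℕ.^ t ℕ.* (∣ boxSum G P ∣ ℕ.* ∣ boxSum G P ∣))  ∎)
    where open ≤-Reasoning

-- The square-free numbers attached to points, and divisibility as box membership.

module SquareFreeFamily where

  open BoxSums
  open ChebyshevBound using (PrimeTable; 0<prime)
  open import Data.Bool using (true; false; if_then_else_)
  open import Data.Fin as Fin using (Fin; zero; suc)
  import Data.Fin.Properties as Fin
  open import Data.Fin.Subset using (Subset; _∈_; _∉_)
  open import Data.Fin.Subset.Properties using (_∈?_)
  open import Data.Integer as ℤ using (ℤ; 0ℤ; 1ℤ)
  import Data.Integer.Properties as ℤ
  open import Data.List using (List; []; _∷_; _++_; map; length)
  import Data.List.Membership.Propositional as List
  open import Data.List.Membership.Propositional.Properties
    using (∈-++⁺ˡ; ∈-++⁺ʳ; ∈-++⁻; ∈-map⁺; ∈-map⁻)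
  open import Data.List.Properties using (length-++; length-map)
  open import Data.List.Relation.Unary.All as All using (All; []; _∷_)
  open import Data.List.Relation.Unary.AllPairs using ([]; _∷_; allPairs?)
  open import Data.List.Relation.Unary.Unique.Propositional using (Unique)
  import Data.List.Relation.Unary.Unique.Propositional.Properties as Unique
  open import Data.Nat
  open import Data.Nat.Coprimality using (Coprime; coprime-divisor)
  open import Data.Nat.Divisibility
  open import Data.Nat.ListAction using (product)
  open import Data.Nat.ListAction.Properties using (product-++; ∈⇒∣product)
  open import Data.Nat.Primality
  open import Data.Nat.Primality.Factorisation using (factorisationHasAllPrimeFactors)
  open import Data.Nat.Properties
  open import Data.Product using (∃; ∃₂; _×_; _,_; proj₁; proj₂)
  open import Data.Sign using (Sign)
  open import Data.Sum using (_⊎_; inj₁; inj₂)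
  open import Data.Vec using (Vec; []; _∷_; lookup; tabulate)
  open import Data.Vec.Properties using ([]=⇒lookup; lookup⇒[]=; lookup∘tabulate)
  open import Data.Vec.Relation.Binary.Pointwise.Extensional using (ext; extensional⇒inductive)
  open import Data.Vec.Relation.Binary.Pointwise.Inductive using (Pointwise-≡⇒≡; []; _∷_)
  open import Function using (_∘_; _⇔_; mk⇔)
  open import Relation.Binary.PropositionalEquality
    using (_≡_; refl; sym; trans; cong; cong₂; subst; module ≡-Reasoning)
  open import Relation.Nullary using (¬_; yes; no; does; contradiction; ¬?)
  open import Relation.Nullary.Decidable using (from-yes; dec-true; does-⇔; _×-dec_; _⊎-dec_)
  open import Relation.Unary using (Decidable)

  open import Algebra.Properties.Semiring.Sum ℤ.+-*-semiring using (sum; sum-cong-≗)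

  prime∣prime⇒≡ : ∀ {p q} → Prime p → Prime q → p ∣ q → p ≡ q
  prime∣prime⇒≡ p-prime q-prime p∣q with prime⇒irreducible q-prime p∣q
  ... | inj₁ refl = contradiction p-prime ¬prime[1]
  ... | inj₂ p≡q  = p≡q

  -- If p is the head u, cancelling one u leaves u dividing the product of the tail, so u recurs
  -- there against uniqueness. Otherwise p² is coprime to u and divides the product of the tail.
  squareFree-product : ∀ {ps} → All Prime ps → Unique ps → SquareFree (product ps)
  squareFree-product []                   []            p p-prime p²∣1 =
    contradiction p-prime (λ p-prime → ¬prime[1] (subst Prime (∣1⇒≡1 (∣-trans (m∣m*n (p * 1)) p²∣1)) p-prime))
  squareFree-product {u ∷ us} (u-prime ∷ us-prime) (u∉us ∷ unique) p p-prime p²∣u*us with p ≟ u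
  ... | yes refl = All.lookup u∉us (factorisationHasAllPrimeFactors u-prime u∣us us-prime) refl
    where
    u∣us : u ∣ product us
    u∣us = *-cancelˡ-∣ u {{prime⇒nonZero u-prime}} (subst (λ z → u * z ∣ u * product us) (*-identityʳ u) p²∣u*us)
  ... | no p≢u = squareFree-product us-prime unique p p-prime (coprime-divisor p²⊥u p²∣u*us)
    where
    p²⊥u : Coprime (p ^ 2) u
    p²⊥u (d∣p² , d∣u) with prime⇒irreducible u-prime d∣u
    ... | inj₁ d≡1  = d≡1
    ... | inj₂ refl with euclidsLemma p (p * 1) u-prime d∣p²
    ...   | inj₁ u∣p   = contradiction (sym (prime∣prime⇒≡ u-prime p-prime u∣p)) p≢u
    ...   | inj₂ u∣p*1 = contradiction (sym (prime∣prime⇒≡ u-prime p-prime (subst (u ∣_) (*-identityʳ p) u∣p*1))) p≢u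

  product-bound : ∀ {N ps} → All (_≤ N) ps → product ps ≤ N ^ length ps
  product-bound []           = ≤-refl
  product-bound (p≤N ∷ ps≤N) = *-mono-≤ p≤N (product-bound ps≤N)

  product-pos : ∀ {ps} → All Prime ps → 0 < product ps
  product-pos []                   = z<s
  product-pos (p-prime ∷ ps-prime) = *-mono-< (0<prime p-prime) (product-pos ps-prime)

  pairsThrough-unique : ∀ i → Unique (pairsThrough i)
  pairsThrough-unique = from-yes (Fin.all? λ i → allPairs? (λ c d → ¬? (c Fin.≟ d)) (pairsThrough i))

  -- Two distinct points lie together in only one pair, and each lies in three. Deciding all 16
  -- cases proves it.
  pairs-separate : ∀ i i′ → i ≡ i′ ⊎ ∃ λ c → i ∈ᵖ c × ¬ (i′ ∈ᵖ c)
  pairs-separate = from-yes (Fin.all? λ i → Fin.all? λ i′ →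
    (i Fin.≟ i′) ⊎-dec Fin.any? λ c → (i ∈ᵖ? c) ×-dec ¬? (i′ ∈ᵖ? c))

  length-pairsThrough : ∀ i → length (pairsThrough i) ≡ 3
  length-pairsThrough = from-yes (Fin.all? λ i → length (pairsThrough i) ≟ 3)

  -- The table is a plain function here, so that the recursion can drop its first row by `q ∘ suc`.
  factors : ∀ {t} → (Fin t → Fin 6 → ℕ) → Vec (Fin 4) t → List ℕ
  factors q []      = []
  factors q (i ∷ x) = map (q zero) (pairsThrough i) ++ factors (q ∘ suc) x

  modulus : ∀ {t} → (Fin t → Fin 6 → ℕ) → Vec (Fin 6) t → ℕ
  modulus q []      = 1
  modulus q (c ∷ P) = q zero c * modulus (q ∘ suc) P

  ∈-factors⁺ : ∀ {t} (q : Fin t → Fin 6 → ℕ) x j {c} → lookup x j ∈ᵖ c → q j c List.∈ factors q x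
  ∈-factors⁺ q (i ∷ x) zero    i∈c = ∈-++⁺ˡ (∈-map⁺ (q zero) i∈c)
  ∈-factors⁺ q (i ∷ x) (suc j) i∈c = ∈-++⁺ʳ (map (q zero) (pairsThrough i)) (∈-factors⁺ (q ∘ suc) x j i∈c)

  ∈-factors⁻ : ∀ {t} (q : Fin t → Fin 6 → ℕ) x {p} → p List.∈ factors q x →
               ∃₂ λ j c → p ≡ q j c × lookup x j ∈ᵖ c
  ∈-factors⁻ q (i ∷ x) p∈ with ∈-++⁻ (map (q zero) (pairsThrough i)) p∈
  ... | inj₁ p∈map = let c , i∈c , p≡ = ∈-map⁻ (q zero) p∈map in zero , c , p≡ , i∈c
  ... | inj₂ p∈fs  = let j , c , p≡ , i∈c = ∈-factors⁻ (q ∘ suc) x p∈fs in suc j , c , p≡ , i∈c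

  length-factors : ∀ {t} (q : Fin t → Fin 6 → ℕ) x → length (factors q x) ≡ 3 * t
  length-factors q []            = refl
  length-factors {suc t} q (i ∷ x) = begin
    length (map (q zero) (pairsThrough i) ++ factors (q ∘ suc) x)           ≡⟨ length-++ (map (q zero) (pairsThrough i)) ⟩
    length (map (q zero) (pairsThrough i)) + length (factors (q ∘ suc) x)   ≡⟨ cong₂ _+_ (trans (length-map (q zero) (pairsThrough i)) (length-pairsThrough i)) (length-factors (q ∘ suc) x) ⟩
    3 + 3 * t                                                               ≡⟨ *-suc 3 t ⟨
    3 * suc t                                                               ∎
    where open ≡-Reasoning

  lookup∣modulus : ∀ {t} (q : Fin t → Fin 6 → ℕ) P j → q j (lookup P j) ∣ modulus q P
  lookup∣modulus q (c ∷ P) zero    = m∣m*n (modulus (q ∘ suc) P)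
  lookup∣modulus q (c ∷ P) (suc j) = ∣n⇒∣m*n (q zero c) (lookup∣modulus (q ∘ suc) P j)

  modulus-pos : ∀ {t} (q : Fin t → Fin 6 → ℕ) P → (∀ j c → 0 < q j c) → 0 < modulus q P
  modulus-pos q []      0<q = z<s
  modulus-pos q (c ∷ P) 0<q = *-mono-< (0<q zero c) (modulus-pos (q ∘ suc) P (0<q ∘ suc))

  ∈ᵇ⇒modulus∣ : ∀ {t} (q : Fin t → Fin 6 → ℕ) {x P} → x ∈ᵇ P → modulus q P ∣ product (factors q x)
  ∈ᵇ⇒modulus∣ q []                  = ∣-refl
  ∈ᵇ⇒modulus∣ q {i ∷ x} (i∈c ∷ x∈P) = subst (_ ∣_) (sym (product-++ (map (q zero) (pairsThrough i)) (factors (q ∘ suc) x)))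
    (*-pres-∣ (∈⇒∣product (∈-map⁺ (q zero) i∈c)) (∈ᵇ⇒modulus∣ (q ∘ suc) x∈P))

  -- Within one block distinct pairs give distinct primes; different blocks use different rows of
  -- the table.
  factors-unique : ∀ {t} (q : Fin t → Fin 6 → ℕ) → (∀ {j c j′ c′} → q j c ≡ q j′ c′ → j ≡ j′ × c ≡ c′) →
                   ∀ x → Unique (factors q x)
  factors-unique q q-injective []      = []
  factors-unique q q-injective (i ∷ x) = Unique.++⁺
    (Unique.map⁺ (proj₂ ∘ q-injective) (pairsThrough-unique i))
    (factors-unique (q ∘ suc) (λ eq → let j≡ , c≡ = q-injective eq in Fin.suc-injective j≡ , c≡) x)
    (λ (p∈map , p∈fs) →
      let c , _ , p≡ = ∈-map⁻ (q zero) p∈map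
          j , c′ , p≡′ , _ = ∈-factors⁻ (q ∘ suc) x p∈fs
      in contradiction (proj₁ (q-injective (trans (sym p≡) p≡′))) λ ())

  module _ {t N} (table : PrimeTable t 6 N) where
    open PrimeTable table

    number : Vec (Fin 4) t → ℕ
    number x = product (factors entry x)

    factors-prime : ∀ x → All Prime (factors entry x)
    factors-prime x = All.tabulate λ p∈ → let j , c , p≡ , _ = ∈-factors⁻ entry x p∈ in subst Prime (sym p≡) (isPrime j c)

    -- A prime dividing a product of primes is one of them, and injectivity of the table identifies
    -- its row and column.
    entry∣number⇒ : ∀ {j c} x → entry j c ∣ number x → lookup x j ∈ᵖ c
    entry∣number⇒ {j} {c} x q∣ with ∈-factors⁻ entry x (factorisationHasAllPrimeFactors (isPrime j c) q∣ (factors-prime x))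
    ... | j′ , c′ , q≡ , i∈c with injective q≡
    ...   | refl , refl = i∈c

    number-pos : ∀ x → 0 < number x
    number-pos x = product-pos (factors-prime x)

    number-squareFree : ∀ x → SquareFree (number x)
    number-squareFree x = squareFree-product (factors-prime x) (factors-unique entry injective x)

    number-≤ : ∀ x → number x ≤ N ^ (3 * t)
    number-≤ x = subst (λ l → number x ≤ N ^ l) (length-factors entry x)
      (product-bound (All.tabulate λ p∈ → let j , c , p≡ , _ = ∈-factors⁻ entry x p∈ in subst (_≤ N) (sym p≡) (bounded j c)))

    -- Where two points differ in a coordinate, some pair contains one entry and not the other, and
    -- its prime divides only one of the two numbers.
    number-injective : ∀ {x y} → number x ≡ number y → x ≡ y
    number-injective {x} {y} eq = Pointwise-≡⇒≡ (extensional⇒inductive (ext same))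
      where
      same : ∀ j → lookup x j ≡ lookup y j
      same j with pairs-separate (lookup x j) (lookup y j)
      ... | inj₁ x≡y              = x≡y
      ... | inj₂ (c , x∈c , y∉c) =
        contradiction (entry∣number⇒ y (subst (entry j c ∣_) eq (∈⇒∣product (∈-factors⁺ entry x j x∈c)))) y∉c

    -- Forwards, every prime of the modulus divides the number and so forces its coordinate;
    -- backwards, each block of three primes contributes one to the modulus.
    modulus∣number⇔ : ∀ x P → modulus entry P ∣ number x ⇔ x ∈ᵇ P
    modulus∣number⇔ x P = mk⇔
      (λ m∣x → extensional⇒inductive (ext λ j → entry∣number⇒ x (∣-trans (lookup∣modulus entry P j) m∣x)))
      (∈ᵇ⇒modulus∣ entry)

  -- The numbers as a subset of {1, ..., n}, and its signed sums.

  subset : ∀ {n} {P : Fin n → Set} → Decidable P → Subset n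
  subset P? = tabulate (does ∘ P?)

  ∈-subset⁺ : ∀ {n} {P : Fin n → Set} (P? : Decidable P) {i} → P i → i ∈ subset P?
  ∈-subset⁺ P? {i} p = lookup⇒[]= i _ (trans (lookup∘tabulate (does ∘ P?) i) (dec-true (P? i) p))

  ∈-subset⁻ : ∀ {n} {P : Fin n → Set} (P? : Decidable P) {i} → i ∈ subset P? → P i
  ∈-subset⁻ P? {i} i∈ with P? i | trans (sym (lookup∘tabulate (does ∘ P?) i)) ([]=⇒lookup i∈)
  ... | yes p | _  = p
  ... | no _  | ()

  -- Extension by zero to all indices, which frees the sums from membership proofs.
  colour : ∀ {n} {W : Subset n} → Colouring W → Fin n → ℤ
  colour {W = W} f i with i ∈? W
  ... | yes i∈W = sign (f (i , i∈W))
  ... | no  _   = 0ℤ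

  colour-∈ : ∀ {n} {W : Subset n} (f : Colouring W) {i} → i ∈ W → colour f i ℤ.* colour f i ≡ 1ℤ
  colour-∈ {W = W} f {i} i∈W with i ∈? W
  ... | no i∉W   = contradiction i∈W i∉W
  ... | yes i∈W′ with f (i , i∈W′)
  ...   | Sign.+ = refl
  ...   | Sign.- = refl

  colour-∉ : ∀ {n} {W : Subset n} (f : Colouring W) {i} → i ∉ W → colour f i ≡ 0ℤ
  colour-∉ {W = W} f {i} i∉W with i ∈? W
  ... | yes i∈W = contradiction i∈W i∉W
  ... | no  _   = refl

  multipleSum-colour : ∀ {n} (W : Subset n) f a →
    multipleSum W f a ≡ sum λ i → if does (a ∣? value i) then colour f i else 0ℤ
  multipleSum-colour W f a = trans (proj₂ summand) (sum-cong-≗ pointwise)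
    where
    -- The summand of multipleSum is local to its definition; unification recovers it.
    summand : ∃ λ h → multipleSum W f a ≡ sum h
    summand = _ , refl
    pointwise : ∀ i → proj₁ summand i ≡ (if does (a ∣? value i) then colour f i else 0ℤ)
    pointwise i with i ∈? W | a ∣? value i
    ... | yes _ | yes _ = refl
    ... | yes _ | no  _ = refl
    ... | no  _ | yes _ = refl
    ... | no  _ | no  _ = refl

  if-zero : ∀ b {z : ℤ} → z ≡ 0ℤ → (if b then z else 0ℤ) ≡ 0ℤ
  if-zero true  z≡0 = z≡0
  if-zero false _   = refl

  module _ {t N n} (table : PrimeTable t 6 N) (N^3t≤n : N ^ (3 * t) ≤ n) where
    open PrimeTable table using (entry; isPrime)

    private
      pred-bound : ∀ x → pred (number table x) < n
      pred-bound x = subst (_≤ n) (sym (suc-pred (number table x) {{>-nonZero (number-pos table x)}}))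
                       (≤-trans (number-≤ table x) N^3t≤n)

    -- Index i stands for the integer 1 + i, hence the predecessor of the number.
    position : Vec (Fin 4) t → Fin n
    position x = Fin.fromℕ< (pred-bound x)

    value-position : ∀ x → value (position x) ≡ number table x
    value-position x = trans (cong suc (Fin.toℕ-fromℕ< (pred-bound x)))
                             (suc-pred (number table x) {{>-nonZero (number-pos table x)}})

    position-injective : ∀ {x y} → position x ≡ position y → x ≡ y
    position-injective {x} {y} eq = number-injective table
      (trans (sym (value-position x)) (trans (cong value eq) (value-position y)))

    inImage? : Decidable λ i → ∃ λ x → position x ≡ i
    inImage? i = any?ᵛ t λ x → position x Fin.≟ i

    numbers : Subset n
    numbers = subset inImage?

    numbers-squareFree : ∀ {i} → i ∈ numbers → SquareFree (value i)
    numbers-squareFree i∈W with ∈-subset⁻ inImage? i∈W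
    ... | x , refl = subst SquareFree (sym (value-position x)) (number-squareFree table x)

    -- Indices outside the image of `position` have colour 0, so the sum runs over points; there
    -- divisibility by the modulus is membership in the box.
    multipleSum-modulus : ∀ f P → multipleSum numbers f (modulus entry P) ≡ boxSum (colour f ∘ position) P
    multipleSum-modulus f P = begin
      multipleSum numbers f a                                                    ≡⟨ multipleSum-colour numbers f a ⟩
      sum (λ i → if does (a ∣? value i) then colour f i else 0ℤ)
        ≡⟨ sum-image t position position-injective (λ i → if does (a ∣? value i) then colour f i else 0ℤ)
             (λ i none → if-zero (does (a ∣? value i)) (colour-∉ f (none ∘ ∈-subset⁻ inImage?))) ⟩
      sumᵛ t (λ x → if does (a ∣? value (position x)) then colour f (position x) else 0ℤ)
        ≡⟨ sumᵛ-cong t (λ x → cong (if_then colour f (position x) else 0ℤ)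
             (does-⇔ (modulus∣position⇔ x) (a ∣? value (position x)) (x ∈ᵇ? P))) ⟩
      boxSum (colour f ∘ position) P                                             ∎
      where
      open ≡-Reasoning
      a = modulus entry P
      modulus∣position⇔ : ∀ x → a ∣ value (position x) ⇔ x ∈ᵇ P
      modulus∣position⇔ x = subst (λ b → a ∣ b ⇔ x ∈ᵇ P) (sym (value-position x)) (modulus∣number⇔ table x P)

    large-multipleSum : ∀ (f : Colouring numbers) → ∃ λ a → 0 < a ×
      8 ^ t ≤ 6 ^ t * (ℤ.∣ multipleSum numbers f a ∣ * ℤ.∣ multipleSum numbers f a ∣)
    large-multipleSum f =
      let P , le = large-boxSum t (colour f ∘ position) (λ x → colour-∈ f (∈-subset⁺ inImage? (x , refl))) in
      modulus entry P , modulus-pos entry P (λ j c → 0<prime (isPrime j c)) ,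
      subst (λ S → 8 ^ t ≤ 6 ^ t * (ℤ.∣ S ∣ * ℤ.∣ S ∣)) (sym (multipleSum-modulus f P)) le

-- Choice of the parameters and assembly.

open RealPowers using (fromℚ-isReal; real-power-bound)
open ChebyshevBound using (n<2^n; primeTable)
open SquareFreeFamily using (numbers; numbers-squareFree; large-multipleSum)

open import Data.Fin.Subset using (Subset; _∈_)
open import Data.Integer using (∣_∣; +_)
open import Data.Nat using (ℕ; suc; _<_; _*_; _^_; s≤s; z≤n)
open import Data.Nat.Properties
open import Data.Nat.Tactic.RingSolver using (solve-∀)
open import Data.Product using (∃; _×_; _,_)
import Data.Rational as ℚ
import Data.Rational.Properties as ℚ
open import Relation.Binary.PropositionalEquality using (_≡_; trans; cong)
open import Relation.Nullary.Decidable using (from-yes)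

-- The upper bound for products of 3t primes, each at most 2^(8s), is itself the chosen n.
[2^8s]^3t≡2^24st : ∀ s t → (2 ^ (8 * s)) ^ (3 * t) ≡ 2 ^ (24 * (s * t))
[2^8s]^3t≡2^24st s t = trans (^-*-assoc 2 (8 * s) (3 * t)) (cong (2 ^_) (regroup s t))
  where
  regroup : ∀ s t → 8 * s * (3 * t) ≡ 24 * (s * t)
  regroup = solve-∀

theorem1p2 : ∃ λ (C : Cut) → IsReal C × fromℕ 0 <ℝ C ×
    (∀ (N : ℕ) → ∃ λ (n : ℕ) → N < n ×
    ∃ λ (W : Subset n) →
    (∀ {i} → i ∈ W → SquareFree (value i)) ×
    (∀ (f : Colouring W) → ∃ λ (a : ℕ) → 0 < a ×
    fromℕ ∣ multipleSum W f a ∣ ≥ℝ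
    fromℕ n ^ℝ ((C *ℝ log (log (fromℕ n))) ⁻¹)))
theorem1p2 = fromℕ 384 , fromℚ-isReal (+ 384 ℚ./ 1) , 0<384 , λ N →
  -- Taking N + 1 makes s positive, as the prime count requires, and pushes n beyond N.
  let s = suc N
      t = 2 ^ s
      table = primeTable s (s≤s z≤n)
      N^3t≤n = ≤-reflexive ([2^8s]^3t≡2^24st s t)
  in 2 ^ (24 * (s * t)) , N<n N , numbers table N^3t≤n , numbers-squareFree table N^3t≤n , λ f →
    let a , 0<a , large = large-multipleSum table N^3t≤n f
    in a , 0<a , real-power-bound s ∣ multipleSum (numbers table N^3t≤n) f a ∣ (s≤s z≤n) large
  where
  0<384 : fromℕ 0 <ℝ fromℕ 384
  0<384 = ℚ.1ℚ , ℚ.positive⁻¹ ℚ.1ℚ , from-yes (ℚ.1ℚ ℚ.<? (+ 384 ℚ./ 1))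
  N<n : ∀ N → N < 2 ^ (24 * (suc N * 2 ^ suc N))
  N<n N = begin-strict
    N                             <⟨ n<1+n N ⟩
    suc N                         ≤⟨ m≤m*n (suc N) (2 ^ suc N) {{m^n≢0 2 (suc N)}} ⟩
    suc N * 2 ^ suc N             ≤⟨ m≤n*m (suc N * 2 ^ suc N) 24 ⟩
    24 * (suc N * 2 ^ suc N)      <⟨ n<2^n _ ⟩
    2 ^ (24 * (suc N * 2 ^ suc N)) ∎
    where open ≤-Reasoning
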